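{- Let $(\alpha_n)_{n\ge0}$ be complex numbers with $0<|\alpha_n|<1$ for all $n$, and let $\mu_{n,r,s}$ be as in the context. For all nonnegative integers $n,r,s$, \[ \mu_{n,r,s}=\sum_{p\in\mathrm{Sch}_{n,r,s}}\mathrm{wt}_S(p). \]
   Context: For a polynomial $f(z)=\sum_{k=0}^n a_kz^k$ of degree $n$, write $\overline{f}(z)=\sum_k\overline{a_k}z^k$ and $f^*(z)=z^n\overline{f}(1/z)$. Define monic $\Phi_n$ by $\Phi_0=1$, $\Phi_{n+1}(z)=z\Phi_n(z)-\overline{\alpha_n}\Phi_n^*(z)$. Let $\mathcal{L}$ be the unique linear functional on Laurent polynomials with $\mathcal{L}(1)=1$ and $\mathcal{L}(\Phi_m(z)\overline{\Phi_n}(1/z))=0$ for $m\neq n$; set $\langle f,g\rangle=\mathcal{L}(f(z)\overline{g}(1/z))$ and $\mu_{n,r,s}=\langle\Phi_s(z),z^n\Phi_r(z)\rangle/\langle\Phi_s,\Phi_s\rangle$. Set $\alpha_{ -1}=-1$. A Schröder path is a lattice path in $\mathbb{Z}\times\mathbb{Z}_{\ge0}$ with steps $(1,1)$, $(1,0)$, $(0,-1)$; $\mathrm{Sch}_{n,r,s}$ is the set of Schröder paths from $(0,r)$ to $(n,s)$ that do not start with a vertical down-step $(0,-1)$. The weight $\mathrm{wt}_S(p)$ is the product of step weights: $(a,b)\to(a+1,b+1)$ has weight $1$; $(a,b)\to(a+1,b)$ has weight $-\overline{\alpha_{b-1}}/\overline{\alpha_b}$; $(a,b)\to(a,b-1)$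 has weight $\frac{\overline{\alpha_{b-2}}}{\overline{\alpha_{b-1}}}(1-|\alpha_{b-1}|^2)$. -}

module Defs where

open import Algebra.Apartness.Bundles using (HeytingField; HeytingCommutativeRing)
import Algebra.Apartness.Properties.HeytingCommutativeRing as HeytingProperties
open import Algebra.Bundles using (CommutativeRing; CommutativeSemiring)
open import Algebra.Module.Bundles.Raw using (RawLeftModule)
open import Algebra.Module.Morphism.Structures using (module LeftModuleMorphisms)
import Algebra.Definitions.RawMonoid as RawMonoidDefinitions
import Algebra.Properties.Ring as RingProperties
import Algebra.Solver.Ring.NaturalCoefficients.Default as SemiringSolver
open import Data.Empty using (⊥; ⊥-elim)
open import Data.Integer.Base as ℤ using (ℤ; +_; 0ℤ; 1ℤ)
import Data.Integer.Properties as ℤₚ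
open import Data.List.Base as List using (List; []; _∷_; _++_; filter; foldr; cartesianProductWith)
open import Data.List.Membership.Propositional using (_∈_)
open import Data.List.Membership.Propositional.Properties
  using (∈-map⁺; ∈-map⁻; ∈-++⁺ˡ; ∈-++⁺ʳ; ∈-++⁻; ∈-filter⁺; ∈-filter⁻)
open import Data.List.Relation.Unary.All using ([])
open import Data.List.Relation.Unary.AllPairs using ([]; _∷_)
open import Data.List.Relation.Unary.Any using (here)
open import Data.List.Relation.Unary.Unique.Propositional using (Unique)
import Data.List.Relation.Unary.Unique.Propositional.Properties as Unique
open import Data.Nat.Base as ℕ using (ℕ; zero; suc)
import Data.Nat.Properties as ℕₚ
open import Data.Product.Base using (_×_; _,_; proj₁; proj₂; ∃-syntax)
import Data.Product.Properties as Prod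
open import Data.Sum.Base using (_⊎_; inj₁; inj₂; [_,_]′)
open import Function.Base using (_∘_; id)
open import Function.Bundles using (_⇔_; mk⇔; Equivalence)
open import Level using (0ℓ; _⊔_) renaming (suc to lsuc)
open import Relation.Binary.Construct.Closure.ReflexiveTransitive using (Star; ε; _◅_; fold)
open import Relation.Binary.Core using (Rel)
open import Relation.Binary.PropositionalEquality as ≡ using (_≡_; _≢_)
open import Relation.Binary.Structures using (IsStrictPartialOrder)
open import Relation.Nullary using (¬_; Dec; yes; no; ¬?)

-- The standard library has no real numbers, so ℝ is specified by the axioms
-- that determine it up to isomorphism: an Archimedean, Dedekind-complete
-- ordered field.  The axioms are arranged to be meaningful constructively:
-- apartness is _#_, and x ≤ y is rendered as ¬ y < x.

record Reals c ℓ₁ ℓ₂ : Set (lsuc (c ⊔ ℓ₁ ⊔ ℓ₂)) where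
  field
    heytingField : HeytingField c ℓ₁ ℓ₂

  open HeytingField heytingField public

  infix 4 _<_
  field
    _<_                    : Rel Carrier ℓ₂
    <-isStrictPartialOrder : IsStrictPartialOrder _≈_ _<_
    #⇔<⊎>                  : ∀ x y → x # y ⇔ (x < y ⊎ y < x)
    +-monoˡ-<              : ∀ z {x y} → x < y → x + z < y + z
    *-pos                  : ∀ {x y} → 0# < x → 0# < y → 0# < x * y

  commutativeRing : CommutativeRing c ℓ₁
  commutativeRing = HeytingCommutativeRing.commutativeRing
    (HeytingField.heytingCommutativeRing heytingField)

  open CommutativeRing commutativeRing public
    using (ring; commutativeSemiring; +-rawMonoid)

  open RawMonoidDefinitions +-rawMonoid public using () renaming (_×_ to _·_)

  field
    archimedean : ∀ x → ∃[ n ] x < n · 1#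

    -- Every located cut (L , U) is realised by a number x with L ≤ x ≤ U.
    complete    : (L U : Carrier → Set ℓ₂) →
                  ∃[ q ] L q → ∃[ r ] U r →
                  (∀ {q r} → L q → U r → ¬ r < q) →
                  (∀ {q r} → q < r → L q ⊎ U r) →
                  ∃[ x ] ((∀ {q} → L q → ¬ x < q) × (∀ {r} → U r → ¬ r < x))

  module < = IsStrictPartialOrder <-isStrictPartialOrder

private module SemiringIdentities {c ℓ} (S : CommutativeSemiring c ℓ) where
  open CommutativeSemiring S
  open SemiringSolver S using (solve; _:=_; _:+_; _:*_; con)

  [x+1]² : ∀ x → x + (x * x + (x + 1#)) ≈ (x + 1#) * (x + 1#)
  [x+1]² = solve 1 (λ x → x :+ (x :* x :+ (x :+ con 1)) := (x :+ con 1) :* (x :+ con 1)) refl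

  [x+d]² : ∀ x d → x * x + d * (x + (x + d)) ≈ (x + d) * (x + d)
  [x+d]² = solve 2 (λ x d → x :* x :+ d :* (x :+ (x :+ d)) := (x :+ d) :* (x :+ d)) refl

  e[2s²] : ∀ e s → e * (s * s + s * s) ≈ s * ((s + s) * e)
  e[2s²] = solve 2 (λ e s → e :* (s :* s :+ s :* s) := s :* ((s :+ s) :* e)) refl

  [2s]²x : ∀ s x → ((s + s) * (s + s)) * x ≈ ((s * s + s * s) + (s * s + s * s)) * x
  [2s]²x = solve 2 (λ s x → ((s :+ s) :* (s :+ s)) :* x := ((s :* s :+ s :* s) :+ (s :* s :+ s :* s)) :* x) refl

  4yx+d² : ∀ x d → (((x + d) + (x + d)) + ((x + d) + (x + d))) * x + d * d ≈ (x + (x + d)) * (x + (x + d))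
  4yx+d² = solve 2 (λ x d → (((x :+ d) :+ (x :+ d)) :+ ((x :+ d) :+ (x :+ d))) :* x :+ d :* d := (x :+ (x :+ d)) :* (x :+ (x :+ d))) refl

  [te]²x : ∀ t e x → ((t * e) * (t * e)) * x ≈ (e * e) * ((t * t) * x)
  [te]²x = solve 3 (λ t e x → ((t :* e) :* (t :* e)) :* x := (e :* e) :* ((t :* t) :* x)) refl

  [ey]² : ∀ e y → (e * e) * (y * y) ≈ (e * y) * (e * y)
  [ey]² = solve 2 (λ e y → (e :* e) :* (y :* y) := (e :* y) :* (e :* y)) refl

module RealProperties {c ℓ₁ ℓ₂} (R : Reals c ℓ₁ ℓ₂) where
  open Reals R
  open HeytingProperties (HeytingField.heytingCommutativeRing heytingField)
    using (1#0; x-0≈x; #-congʳ; invertibleʳ⇒#)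
  open RingProperties ring using (-‿distribˡ-*; -‿distribʳ-*; -‿involutive)
  private open module Id = SemiringIdentities commutativeSemiring

  private variable
    x y z u v : Carrier

  #⇒<⊎> : x # y → x < y ⊎ y < x
  #⇒<⊎> = Equivalence.to (#⇔<⊎> _ _)

  <-resp : x ≈ y → u ≈ v → x < u → y < v
  <-resp p q = <.<-respˡ-≈ p ∘ <.<-respʳ-≈ q

  <-cotrans : x < y → ∀ z → x < z ⊎ z < y
  <-cotrans {x} {y} x<y z with #-cotrans (Equivalence.from (#⇔<⊎> x y) (inj₁ x<y)) z
  ... | inj₁ x#z with #⇒<⊎> x#z
  ...   | inj₁ x<z = inj₁ x<z
  ...   | inj₂ z<x = inj₂ (<.trans z<x x<y)
  <-cotrans {x} {y} x<y z | inj₂ z#y with #⇒<⊎> z#y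
  ...   | inj₁ z<y = inj₂ z<y
  ...   | inj₂ y<z = inj₁ (<.trans x<y y<z)

  ≤-<-trans : ¬ y < x → y < z → x < z
  ≤-<-trans {x = x} x≤y y<z = [ ⊥-elim ∘ x≤y , id ]′ (<-cotrans y<z x)

  ≮∧≯⇒≈ : ¬ x < y → ¬ y < x → x ≈ y
  ≮∧≯⇒≈ {x} {y} p q = proj₁ (tight x y) ([ p , q ]′ ∘ #⇒<⊎>)

  +-monoʳ-< : ∀ z → x < y → z + x < z + y
  +-monoʳ-< z x<y = <-resp (+-comm _ _) (+-comm _ _) (+-monoˡ-< z x<y)

  x<x+y : ∀ x → 0# < y → x < x + y
  x<x+y x 0<y = <.<-respˡ-≈ (+-identityʳ x) (+-monoʳ-< x 0<y)

  +-pos : ¬ x < 0# → 0# < y → 0# < x + y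
  +-pos {x} 0≤x 0<y = ≤-<-trans 0≤x (x<x+y x 0<y)

  +-nonneg : ¬ x < 0# → ¬ y < 0# → ¬ x + y < 0#
  +-nonneg {x} {y} 0≤x 0≤y p with <-cotrans p x
  ... | inj₂ x<0   = 0≤x x<0
  ... | inj₁ x+y<x = 0≤y (<-resp (cancel x y) (-‿inverseˡ x) (+-monoʳ-< (- x) x+y<x))
    where
    cancel : ∀ x y → - x + (x + y) ≈ y
    cancel x y = trans (sym (+-assoc _ _ _)) (trans (+-congʳ (-‿inverseˡ x)) (+-identityˡ y))

  gap : x < y → ∃[ d ] (0# < d × x + d ≈ y)
  gap {x} {y} x<y = - x + y ,
    <.<-respˡ-≈ (-‿inverseˡ x) (+-monoʳ-< (- x) x<y) ,
    trans (sym (+-assoc _ _ _)) (trans (+-congʳ (-‿inverseʳ x)) (+-identityˡ y))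

  *-monoʳ-< : 0# < z → x < y → z * x < z * y
  *-monoʳ-< {z} {x} 0<z x<y with gap x<y
  ... | d , 0<d , x+d≈y =
    <.<-respʳ-≈ (trans (sym (distribˡ z x d)) (*-congˡ x+d≈y)) (x<x+y (z * x) (*-pos 0<z 0<d))

  neg-square : ∀ x → - x * - x ≈ x * x
  neg-square x = trans (sym (-‿distribˡ-* x (- x)))
    (trans (-‿cong (sym (-‿distribʳ-* x x))) (-‿involutive (x * x)))

  neg-pos : x < 0# → 0# < - x
  neg-pos {x} x<0 = <-resp (-‿inverseʳ x) (+-identityˡ (- x)) (+-monoˡ-< (- x) x<0)

  #0⇒square-pos : x # 0# → 0# < x * x
  #0⇒square-pos {x} x#0 with #⇒<⊎> x#0
  ... | inj₁ x<0 = <.<-respʳ-≈ (neg-square x) (*-pos (neg-pos x<0) (neg-pos x<0))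
  ... | inj₂ 0<x = *-pos 0<x 0<x

  0<1 : 0# < 1#
  0<1 = <.<-respʳ-≈ (*-identityˡ 1#) (#0⇒square-pos 1#0)

  inverse : x # 0# → ∃[ y ] x * y ≈ 1#
  inverse {x} x#0 with #⇒invertible x#0
  ... | y , _ , [x-0]y≈1 = y , trans (*-congʳ (sym (x-0≈x x))) [x-0]y≈1

  invertible⇒#0 : x * y ≈ 1# → x # 0#
  invertible⇒#0 {x} {y} xy≈1 = invertibleʳ⇒# (y , trans (*-congʳ (x-0≈x x)) xy≈1)

  pos⇒#0 : 0# < x → x # 0#
  pos⇒#0 = Equivalence.from (#⇔<⊎> _ _) ∘ inj₂

  square-#0 : x * x # 0# → x # 0#
  square-#0 {x} xx#0 with inverse xx#0
  ... | y , xxy≈1 = invertible⇒#0 (trans (sym (*-assoc x x y)) xxy≈1)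

  square-nonneg : ∀ x → ¬ x * x < 0#
  square-nonneg x xx<0 =
    <.asym xx<0 (#0⇒square-pos (square-#0 (Equivalence.from (#⇔<⊎> _ _) (inj₁ xx<0))))

  inverse-pos : 0# < x → ∃[ y ] (0# < y × x * y ≈ 1#)
  inverse-pos {x} 0<x with inverse (pos⇒#0 0<x)
  ... | y , xy≈1 with #⇒<⊎> (invertible⇒#0 (trans (*-comm y x) xy≈1))
  ...   | inj₂ 0<y = y , 0<y , xy≈1
  ...   | inj₁ y<0 = ⊥-elim (<.asym 0<1
          (<-resp xy≈1 (zeroʳ x) (*-monoʳ-< 0<x y<0)))

  square-mono : 0# < x + y → x < y → x * x < y * y
  square-mono {x} {y} 0<x+y x<y with gap x<y
  ... | d , 0<d , x+d≈y = <.<-respʳ-≈ eq (x<x+y (x * x) (*-pos 0<d 0<x+y))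
    where
    eq : x * x + d * (x + y) ≈ y * y
    eq = trans (+-congˡ (*-congˡ (+-congˡ (sym x+d≈y))))
           (trans ([x+d]² x d)
             (*-cong x+d≈y x+d≈y))

  -- If d = x - s² > 0, then q = s + d / (2s + d + 1) exceeds s and q² < x.
  enlarge : ∀ {s x} → ¬ s < 0# → s * s < x → ∃[ q ] (s < q × q * q < x)
  enlarge {s} {x} 0≤s ss<x =
    s + δ , x<x+y s 0<δ , <-resp (trans (+-congˡ (*-congˡ (+-assoc s s δ))) ([x+d]² s δ))
      (trans (+-congˡ δm≈d) ss+d≈x) (+-monoʳ-< (s * s) (*-monoʳ-< 0<δ 2s+δ<m))
    where
    d = proj₁ (gap ss<x)
    0<d = proj₁ (proj₂ (gap ss<x))
    ss+d≈x = proj₂ (proj₂ (gap ss<x))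

    m : Carrier
    m = s + s + d + 1#

    0<2s+d : 0# < s + s + d
    0<2s+d = +-pos (+-nonneg 0≤s 0≤s) 0<d

    m⁻¹ : ∃[ e ] (0# < e × m * e ≈ 1#)
    m⁻¹ = inverse-pos (+-pos (<.asym 0<2s+d) 0<1)

    e δ : Carrier
    e = proj₁ m⁻¹
    δ = d * e

    0<δ : 0# < δ
    0<δ = *-pos 0<d (proj₁ (proj₂ m⁻¹))

    δm≈d : δ * m ≈ d
    δm≈d = trans (*-assoc d e m)
      (trans (*-congˡ (trans (*-comm e m) (proj₂ (proj₂ m⁻¹)))) (*-identityʳ d))

    δ<d : δ < d
    δ<d = <-resp (*-identityʳ δ) δm≈d (*-monoʳ-< 0<δ
            (<.<-respʳ-≈ (+-comm _ _) (x<x+y 1# 0<2s+d)))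

    2s+δ<m : s + s + δ < m
    2s+δ<m = <.trans (+-monoʳ-< (s + s) δ<d) (x<x+y _ 0<1)

  -- If d = s² - x > 0, then r = (s² + x) / 2s is less than s and r² > x.
  reduce : ∀ {s x} → ¬ s < 0# → ¬ x < 0# → x < s * s → ∃[ r ] (r < s × 0# < r × x < r * r)
  reduce {s} {x} 0≤s 0≤x x<ss = r , r<s , 0<r , x<rr
    where
    d = proj₁ (gap x<ss)
    0<d = proj₁ (proj₂ (gap x<ss))
    x+d≈ss = proj₂ (proj₂ (gap x<ss))

    0<ss : 0# < s * s
    0<ss = ≤-<-trans 0≤x x<ss

    0<s : 0# < s
    0<s = [ ⊥-elim ∘ 0≤s , id ]′ (#⇒<⊎> (square-#0 (pos⇒#0 0<ss)))

    [2s]⁻¹ : ∃[ e ] (0# < e × (s + s) * e ≈ 1#)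
    [2s]⁻¹ = inverse-pos (+-pos 0≤s 0<s)

    e r : Carrier
    e = proj₁ [2s]⁻¹
    r = e * (x + s * s)

    0<e : 0# < e
    0<e = proj₁ (proj₂ [2s]⁻¹)

    2se≈1 : (s + s) * e ≈ 1#
    2se≈1 = proj₂ (proj₂ [2s]⁻¹)

    0<r : 0# < r
    0<r = *-pos 0<e (+-pos 0≤x 0<ss)

    r<s : r < s
    r<s = <.<-respʳ-≈ (trans (e[2s²] e s) (trans (*-congˡ 2se≈1) (*-identityʳ s)))
      (*-monoʳ-< 0<e (+-monoˡ-< (s * s) x<ss))

    ss≈ : s * s ≈ x + d
    ss≈ = sym x+d≈ss

    [2se]² : ((s + s) * e) * ((s + s) * e) ≈ 1#
    [2se]² = trans (*-cong 2se≈1 2se≈1) (*-identityˡ 1#)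

    x≈ : x ≈ (e * e) * ((((x + d) + (x + d)) + ((x + d) + (x + d))) * x)
    x≈ = trans (sym (*-identityˡ x)) (trans (*-congʳ (sym [2se]²))
      (trans ([te]²x (s + s) e x) (*-congˡ (trans ([2s]²x s x)
        (*-congʳ (+-cong (+-cong ss≈ ss≈) (+-cong ss≈ ss≈)))))))

    rr≈ : x + (e * e) * (d * d) ≈ r * r
    rr≈ = trans (+-congʳ x≈) (trans (sym (distribˡ (e * e) _ _))
      (trans (*-congˡ (trans (4yx+d² x d) (*-cong (+-congˡ x+d≈ss) (+-congˡ x+d≈ss))))
        ([ey]² e (x + s * s))))

    x<rr : x < r * r
    x<rr = <.<-respʳ-≈ rr≈ (x<x+y x (*-pos (*-pos 0<e 0<e) (*-pos 0<d 0<d)))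

  module _ {x} (0≤x : ¬ x < 0#) where

    private
      L U : Carrier → Set _
      L q = ¬ 0# < q ⊎ q * q < x
      U r = 0# < r × x < r * r

    U-inhabited : U (x + 1#)
    U-inhabited = 0<x+1 , <.<-respʳ-≈ ([x+1]² x)
      (x<x+y x (+-pos (square-nonneg x) 0<x+1))
      where
      0<x+1 : 0# < x + 1#
      0<x+1 = +-pos 0≤x 0<1

    disjoint : ∀ {q r} → L q → U r → ¬ r < q
    disjoint (inj₁ q≤0)  (0<r , x<rr) r<q = q≤0 (<.trans 0<r r<q)
    disjoint (inj₂ qq<x) (0<r , x<rr) r<q = <.irrefl refl
      (<.trans (<.trans qq<x x<rr) (square-mono (+-pos (<.asym 0<r) (<.trans 0<r r<q)) r<q))

    located : ∀ {q r} → q < r → L q ⊎ U r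
    located {q} {r} q<r =
      [ (λ q<0 → inj₁ (inj₁ (<.asym q<0)))
      , (λ 0<r → [ (λ q<0 → inj₁ (inj₁ (<.asym q<0)))
                 , (λ 0<q+r → [ (λ qq<x → inj₁ (inj₂ qq<x)) , (λ x<rr → inj₂ (0<r , x<rr)) ]′
                                (<-cotrans (square-mono 0<q+r q<r) x))
                 ]′ (<-cotrans (x<x+y q 0<r) 0#))
      ]′ (<-cotrans q<r 0#)

    abstract
      sqrt-exists : ∃[ s ] (¬ s < 0# × s * s ≈ x)
      sqrt-exists with complete L U (0# , inj₁ (<.irrefl refl)) (x + 1# , U-inhabited) disjoint located
      ... | s , L≤s , s≤U = s , 0≤s , ≮∧≯⇒≈
        (λ ss<x → let q , s<q , qq<x = enlarge 0≤s ss<x in L≤s (inj₂ qq<x) s<q)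
        (λ x<ss → let r , r<s , 0<r , x<rr = reduce 0≤s 0≤x x<ss in s≤U (0<r , x<rr) r<s)
        where
        0≤s : ¬ s < 0#
        0≤s = L≤s (inj₁ (<.irrefl refl))

  sqrt : ∀ x → ¬ x < 0# → Carrier
  sqrt x 0≤x = proj₁ (sqrt-exists 0≤x)

  sqrt-nonneg : ∀ {x} (0≤x : ¬ x < 0#) → ¬ sqrt x 0≤x < 0#
  sqrt-nonneg 0≤x = proj₁ (proj₂ (sqrt-exists 0≤x))

  sqrt-square : ∀ {x} (0≤x : ¬ x < 0#) → sqrt x 0≤x * sqrt x 0≤x ≈ x
  sqrt-square 0≤x = proj₂ (proj₂ (sqrt-exists 0≤x))

module Complex {c ℓ₁ ℓ₂} (R : Reals c ℓ₁ ℓ₂) where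
  private
    module ℝ where
      open Reals R public
      open RealProperties R public
      open RingProperties ring public using (-‿distribˡ-*; -‿distribʳ-*; -‿involutive)

  open Reals R public using () renaming (Carrier to ℝ; _<_ to _<ℝ_; 0# to 0ℝ; 1# to 1ℝ)

  infixl 6 _+_ _-_
  infixl 7 _*_ _/_⟨_⟩
  infix  8 -_
  infix  4 _≈_
  infix  5 _+i_

  record ℂ : Set c where
    constructor _+i_
    field
      re im : ℝ

  open ℂ public

  _≈_ : Rel ℂ ℓ₁
  z ≈ w = (re z ℝ.≈ re w) × (im z ℝ.≈ im w)

  fromℝ : ℝ → ℂ
  fromℝ x = x +i 0ℝ

  0ℂ 1ℂ : ℂ
  0ℂ = fromℝ 0ℝ
  1ℂ = fromℝ 1ℝ

  -_ : ℂ → ℂ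
  - z = (ℝ.- re z) +i (ℝ.- im z)

  _+_ _-_ _*_ : ℂ → ℂ → ℂ
  z + w = (re z ℝ.+ re w) +i (im z ℝ.+ im w)
  z - w = z + - w
  z * w = (re z ℝ.* re w ℝ.- im z ℝ.* im w) +i (re z ℝ.* im w ℝ.+ im z ℝ.* re w)

  conj : ℂ → ℂ
  conj z = re z +i (ℝ.- im z)

  normSq : ℂ → ℝ
  normSq z = re z ℝ.* re z ℝ.+ im z ℝ.* im z

  normSq-nonneg : ∀ z → ¬ normSq z <ℝ 0ℝ
  normSq-nonneg z = ℝ.+-nonneg (ℝ.square-nonneg (re z)) (ℝ.square-nonneg (im z))

  ∣_∣ : ℂ → ℝ
  ∣ z ∣ = ℝ.sqrt (normSq z) (normSq-nonneg z)

  -- z ≠ 0 in the positive sense, as needed to invert z.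
  NonZero : ℂ → Set ℓ₂
  NonZero z = 0ℝ <ℝ ∣ z ∣

  ∣∣²≈normSq : ∀ z → ∣ z ∣ ℝ.* ∣ z ∣ ℝ.≈ normSq z
  ∣∣²≈normSq z = ℝ.sqrt-square (normSq-nonneg z)

  NonZero⇒normSq-pos : ∀ {z} → NonZero z → 0ℝ <ℝ normSq z
  NonZero⇒normSq-pos {z} nz = ℝ.<.<-respʳ-≈ (∣∣²≈normSq z) (ℝ.*-pos nz nz)

  normSq-pos⇒NonZero : ∀ {z} → 0ℝ <ℝ normSq z → NonZero z
  normSq-pos⇒NonZero {z} p =
    [ ⊥-elim ∘ ℝ.sqrt-nonneg (normSq-nonneg z) , id ]′ (ℝ.#⇒<⊎> (ℝ.square-#0
      (ℝ.pos⇒#0 (ℝ.<.<-respʳ-≈ (ℝ.sym (∣∣²≈normSq z)) p))))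

  conj-NonZero : ∀ {z} → NonZero z → NonZero (conj z)
  conj-NonZero {z} nz = normSq-pos⇒NonZero
    (ℝ.<.<-respʳ-≈ (ℝ.+-congˡ (ℝ.sym (ℝ.neg-square (im z)))) (NonZero⇒normSq-pos nz))

  module _ (z : ℂ) (nz : NonZero z) where

    1/normSq : ∃[ n ] normSq z ℝ.* n ℝ.≈ 1ℝ
    1/normSq = ℝ.inverse (ℝ.pos⇒#0 (NonZero⇒normSq-pos nz))

    reciprocal : ℂ
    reciprocal = conj z * fromℝ (proj₁ 1/normSq)

  _/_⟨_⟩ : ℂ → (w : ℂ) → NonZero w → ℂ
  z / w ⟨ nz ⟩ = z * reciprocal w nz

module Laurent {c ℓ₁ ℓ₂} (R : Reals c ℓ₁ ℓ₂) where
  open Complex R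

  infixl 6 _⊕_ _⊖_
  infixl 7 _⊗_
  infixr 7 _•_
  infix  8 ⊖_
  infix  4 _≋_

  -- A Laurent polynomial is a formal sum of terms (k , a), standing for a zᵏ;
  -- repeated exponents are allowed, and equality is equality of coefficients.
  LaurentPoly : Set c
  LaurentPoly = List (ℤ × ℂ)

  coeff : LaurentPoly → ℤ → ℂ
  coeff []            k = 0ℂ
  coeff ((j , a) ∷ f) k with j ℤₚ.≟ k
  ... | yes _ = a + coeff f k
  ... | no  _ = coeff f k

  _≋_ : Rel LaurentPoly ℓ₁
  f ≋ g = ∀ k → coeff f k ≈ coeff g k

  z^ : ℤ → LaurentPoly
  z^ k = List.[ (k , 1ℂ) ]

  0ᴸ 1ᴸ : LaurentPoly
  0ᴸ = []
  1ᴸ = z^ 0ℤ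

  _•_ : ℂ → LaurentPoly → LaurentPoly
  a • f = List.map (λ (k , b) → k , a * b) f

  ⊖_ : LaurentPoly → LaurentPoly
  ⊖ f = List.map (λ (k , b) → k , - b) f

  _⊕_ _⊖_ _⊗_ : LaurentPoly → LaurentPoly → LaurentPoly
  f ⊕ g = f ++ g
  f ⊖ g = f ⊕ (⊖ g)
  f ⊗ g = cartesianProductWith (λ (j , a) (k , b) → j ℤ.+ k , a * b) f g

  -- conjCoeff f is f̄, and f at-1/z is f(1/z).
  conjCoeff : LaurentPoly → LaurentPoly
  conjCoeff f = List.map (λ (k , a) → k , conj a) f

  _at-1/z : LaurentPoly → LaurentPoly
  f at-1/z = List.map (λ (k , a) → ℤ.- k , a) f

  laurentModule : RawLeftModule ℂ c ℓ₁
  laurentModule = record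
    { Carrierᴹ = LaurentPoly ; _≈ᴹ_ = _≋_ ; _+ᴹ_ = _⊕_ ; _*ₗ_ = _•_ ; 0ᴹ = 0ᴸ ; -ᴹ_ = ⊖_ }

  complexModule : RawLeftModule ℂ c ℓ₁
  complexModule = record
    { Carrierᴹ = ℂ ; _≈ᴹ_ = _≈_ ; _+ᴹ_ = _+_ ; _*ₗ_ = _*_ ; 0ᴹ = 0ℂ ; -ᴹ_ = -_ }

  IsLinear : (LaurentPoly → ℂ) → Set (c ⊔ ℓ₁)
  IsLinear = LeftModuleMorphisms.IsLeftModuleHomomorphism laurentModule complexModule

module OrthogonalPolynomials {c ℓ₁ ℓ₂} (R : Reals c ℓ₁ ℓ₂) (α : ℕ → Complex.ℂ R) where
  open Complex R
  open Laurent R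

  -- f ⋆⟨ n ⟩ is f*(z) = zⁿ f̄(1/z) for f of degree n.  The degree is an explicit
  -- argument; Φ n, being monic, has degree n.
  _⋆⟨_⟩ : LaurentPoly → ℕ → LaurentPoly
  f ⋆⟨ n ⟩ = z^ (+ n) ⊗ (conjCoeff f) at-1/z

  Φ : ℕ → LaurentPoly
  Φ zero    = 1ᴸ
  Φ (suc n) = z^ 1ℤ ⊗ Φ n ⊖ conj (α n) • (Φ n ⋆⟨ n ⟩)

  record IsOrthogonalityFunctional (𝓛 : LaurentPoly → ℂ) : Set (c ⊔ ℓ₁) where
    field
      linear     : IsLinear 𝓛
      normalised : 𝓛 1ᴸ ≈ 1ℂ
      orthogonal : ∀ m n → m ≢ n → 𝓛 (Φ m ⊗ (conjCoeff (Φ n)) at-1/z) ≈ 0ℂ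

  module Moments (𝓛 : LaurentPoly → ℂ) where

    ⟪_,_⟫ : LaurentPoly → LaurentPoly → ℂ
    ⟪ f , g ⟫ = 𝓛 (f ⊗ (conjCoeff g) at-1/z)

    μ : (n r s : ℕ) → NonZero ⟪ Φ s , Φ s ⟫ → ℂ
    μ n r s nz = ⟪ Φ s , z^ (+ n) ⊗ Φ r ⟫ / ⟪ Φ s , Φ s ⟫ ⟨ nz ⟩

Point : Set
Point = ℤ × ℕ

data Step : Rel Point 0ℓ where
  diag  : ∀ {a b} → Step (a , b) (ℤ.suc a , suc b)
  level : ∀ {a b} → Step (a , b) (ℤ.suc a , b)
  down  : ∀ {a b} → Step (a , suc b) (a , b)

Path : Rel Point 0ℓ
Path = Star Step

data StartsDown : ∀ {P Q} → Path P Q → Set where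
  starts-down : ∀ {a b Q} {p : Path (a , b) Q} → StartsDown (down ◅ p)

startsDown? : ∀ {P Q} (p : Path P Q) → Dec (StartsDown p)
startsDown? ε           = no λ ()
startsDown? (diag  ◅ p) = no λ ()
startsDown? (level ◅ p) = no λ ()
startsDown? (down  ◅ p) = yes starts-down

-- paths k a b e lists all paths from (a , b) to (c , d) when c = k + a, split by
-- first step; all-paths and paths-unique state that nothing is missing or
-- repeated.

stay : ∀ P Q → List (Path P Q)
stay P Q with Prod.≡-dec ℤₚ._≟_ ℕₚ._≟_ P Q
... | yes ≡.refl = List.[ ε ]
... | no  _      = []

shift : ∀ k a {c} → + suc k ℤ.+ a ≡ c → + k ℤ.+ ℤ.suc a ≡ c
shift k a e = ≡.trans (≡.trans (≡.sym (ℤₚ.+-assoc (+ k) 1ℤ a))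
  (≡.cong (ℤ._+ a) (ℤₚ.+-comm (+ k) 1ℤ))) e

paths              : ∀ k a b {c d} → + k ℤ.+ a ≡ c → List (Path (a , b) (c , d))
diags levels downs : ∀ k a b {c d} → + k ℤ.+ a ≡ c → List (Path (a , b) (c , d))

paths k a b e = stay _ _ ++ diags k a b e ++ levels k a b e ++ downs k a b e

diags zero    a b e = []
diags (suc k) a b e = List.map (diag ◅_) (paths k (ℤ.suc a) (suc b) (shift k a e))

levels zero    a b e = []
levels (suc k) a b e = List.map (level ◅_) (paths k (ℤ.suc a) b (shift k a e))

downs k a zero    e = []
downs k a (suc b) e = List.map (down ◅_) (paths k a b e)

path⇒≤ : ∀ {P Q} → Path P Q → proj₁ P ℤ.≤ proj₁ Q
path⇒≤ ε           = ℤₚ.≤-refl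
path⇒≤ (diag  ◅ p) = ℤₚ.≤-trans (ℤₚ.i≤suc[i] _) (path⇒≤ p)
path⇒≤ (level ◅ p) = ℤₚ.≤-trans (ℤₚ.i≤suc[i] _) (path⇒≤ p)
path⇒≤ (down  ◅ p) = path⇒≤ p

no-advance : ∀ a {c} → + 0 ℤ.+ a ≡ c → ¬ ℤ.suc a ℤ.≤ c
no-advance a e a+1≤c = ℤₚ.i≮i (ℤₚ.suc[i]≤j⇒i<j
  (≡.subst (ℤ.suc a ℤ.≤_) (≡.trans (≡.sym e) (ℤₚ.+-identityˡ a)) a+1≤c))

stay-ε : ∀ P → ε ∈ stay P P
stay-ε P with Prod.≡-dec ℤₚ._≟_ ℕₚ._≟_ P P
... | yes ≡.refl = here ≡.refl
... | no  P≢P    = ⊥-elim (P≢P ≡.refl)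

all-paths : ∀ k a b {c d} (e : + k ℤ.+ a ≡ c) (p : Path (a , b) (c , d)) → p ∈ paths k a b e
all-paths k a b e ε = ∈-++⁺ˡ (stay-ε _)
all-paths zero a b e (diag ◅ p) = ⊥-elim (no-advance a e (path⇒≤ p))
all-paths (suc k) a b e (diag ◅ p) =
  ∈-++⁺ʳ (stay _ _) (∈-++⁺ˡ (∈-map⁺ (diag ◅_) (all-paths k (ℤ.suc a) (suc b) (shift k a e) p)))
all-paths zero a b e (level ◅ p) = ⊥-elim (no-advance a e (path⇒≤ p))
all-paths (suc k) a b e (level ◅ p) =
  ∈-++⁺ʳ (stay _ _) (∈-++⁺ʳ (diags (suc k) a b e)
    (∈-++⁺ˡ (∈-map⁺ (level ◅_) (all-paths k (ℤ.suc a) b (shift k a e) p))))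
all-paths k a (suc b) e (down ◅ p) =
  ∈-++⁺ʳ (stay _ _) (∈-++⁺ʳ (diags k a (suc b) e)
    (∈-++⁺ʳ (levels k a (suc b) e) (∈-map⁺ (down ◅_) (all-paths k a b e p))))

data Kind : Set where
  empty diag level down : Kind

kind : ∀ {P Q} → Path P Q → Kind
kind ε           = empty
kind (diag  ◅ _) = diag
kind (level ◅ _) = level
kind (down  ◅ _) = down

stay-kind : ∀ P Q {p} → p ∈ stay P Q → kind p ≡ empty
stay-kind P Q p∈ with Prod.≡-dec ℤₚ._≟_ ℕₚ._≟_ P Q
stay-kind P Q (here ≡.refl) | yes ≡.refl = ≡.refl
stay-kind P Q ()            | no  _

diags-kind : ∀ k a b {c d} (e : + k ℤ.+ a ≡ c) {p : Path (a , b) (c , d)} →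
             p ∈ diags k a b e → kind p ≡ diag
diags-kind (suc k) a b e p∈ with ∈-map⁻ (diag ◅_) p∈
... | _ , _ , ≡.refl = ≡.refl

levels-kind : ∀ k a b {c d} (e : + k ℤ.+ a ≡ c) {p : Path (a , b) (c , d)} →
              p ∈ levels k a b e → kind p ≡ level
levels-kind (suc k) a b e p∈ with ∈-map⁻ (level ◅_) p∈
... | _ , _ , ≡.refl = ≡.refl

downs-kind : ∀ k a b {c d} (e : + k ℤ.+ a ≡ c) {p : Path (a , b) (c , d)} →
             p ∈ downs k a b e → kind p ≡ down
downs-kind k a (suc b) e p∈ with ∈-map⁻ (down ◅_) p∈
... | _ , _ , ≡.refl = ≡.refl

paths-unique  : ∀ k a b {c d} (e : + k ℤ.+ a ≡ c) → Unique (paths k a b {d = d} e)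
diags-unique  : ∀ k a b {c d} (e : + k ℤ.+ a ≡ c) → Unique (diags k a b {d = d} e)
levels-unique : ∀ k a b {c d} (e : + k ℤ.+ a ≡ c) → Unique (levels k a b {d = d} e)
downs-unique  : ∀ k a b {c d} (e : + k ℤ.+ a ≡ c) → Unique (downs k a b {d = d} e)

stay-unique : ∀ P Q → Unique (stay P Q)
stay-unique P Q with Prod.≡-dec ℤₚ._≟_ ℕₚ._≟_ P Q
... | yes ≡.refl = [] ∷ []
... | no  _      = []

paths-unique k a b {c} {d} e =
  Unique.++⁺ (stay-unique _ _)
    (Unique.++⁺ (diags-unique k a b e)
      (Unique.++⁺ (levels-unique k a b e) (downs-unique k a b e) level#down)
      diag#rest)
    stay#rest
  where
  clash : ∀ {k l : Kind} {p : Path (a , b) (c , d)} → k ≢ l → kind p ≡ k → kind p ≡ l → ⊥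
  clash k≢l p q = k≢l (≡.trans (≡.sym p) q)

  level#down : ∀ {p} → p ∈ levels k a b e × p ∈ downs k a b e → ⊥
  level#down (p , q) = clash (λ ()) (levels-kind k a b e p) (downs-kind k a b e q)

  diag#rest : ∀ {p} → p ∈ diags k a b e × p ∈ levels k a b e ++ downs k a b e → ⊥
  diag#rest (p , q) with ∈-++⁻ (levels k a b e) q
  ... | inj₁ q = clash (λ ()) (diags-kind k a b e p) (levels-kind k a b e q)
  ... | inj₂ q = clash (λ ()) (diags-kind k a b e p) (downs-kind k a b e q)

  stay#rest : ∀ {p} → p ∈ stay _ _ × p ∈ diags k a b e ++ levels k a b e ++ downs k a b e → ⊥
  stay#rest (p , q) with ∈-++⁻ (diags k a b e) q
  ... | inj₁ q = clash (λ ()) (stay-kind _ _ p) (diags-kind k a b e q)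
  ... | inj₂ q with ∈-++⁻ (levels k a b e) q
  ...   | inj₁ q = clash (λ ()) (stay-kind _ _ p) (levels-kind k a b e q)
  ...   | inj₂ q = clash (λ ()) (stay-kind _ _ p) (downs-kind k a b e q)

diags-unique zero    a b e = []
diags-unique (suc k) a b e =
  Unique.map⁺ (λ { ≡.refl → ≡.refl }) (paths-unique k (ℤ.suc a) (suc b) (shift k a e))

levels-unique zero    a b e = []
levels-unique (suc k) a b e =
  Unique.map⁺ (λ { ≡.refl → ≡.refl }) (paths-unique k (ℤ.suc a) b (shift k a e))

downs-unique k a zero    e = []
downs-unique k a (suc b) e = Unique.map⁺ (λ { ≡.refl → ≡.refl }) (paths-unique k a b e)

-- Sch n r s lists the elements of Sch_{n,r,s} without repetition: see ∈-Sch and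
-- Sch-unique.
Sch : (n r s : ℕ) → List (Path (0ℤ , r) (+ n , s))
Sch n r s = filter (¬? ∘ startsDown?) (paths n 0ℤ r (ℤₚ.+-identityʳ (+ n)))

∈-Sch : ∀ n r s (p : Path (0ℤ , r) (+ n , s)) → p ∈ Sch n r s ⇔ (¬ StartsDown p)
∈-Sch n r s p = mk⇔
  (λ p∈ → proj₂ (∈-filter⁻ (¬? ∘ startsDown?) {xs = paths n 0ℤ r (ℤₚ.+-identityʳ (+ n))} p∈))
  (∈-filter⁺ (¬? ∘ startsDown?) (all-paths n 0ℤ r (ℤₚ.+-identityʳ (+ n)) p))

Sch-unique : ∀ n r s → Unique (Sch n r s)
Sch-unique n r s = Unique.filter⁺ (¬? ∘ startsDown?) (paths-unique n 0ℤ r (ℤₚ.+-identityʳ (+ n)))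

module Weights {c ℓ₁ ℓ₂} (R : Reals c ℓ₁ ℓ₂) (α : ℕ → Complex.ℂ R)
               (α≢0 : ∀ n → Complex.NonZero R (α n)) where
  open Complex R
  open Reals R using () renaming (_-_ to _-ℝ_; _*_ to _*ℝ_)

  -- α[ b -1] is α_{b-1}, including α_{-1} = -1.
  α[_-1] : ℕ → ℂ
  α[ zero  -1] = - 1ℂ
  α[ suc b -1] = α b

  stepWt : ∀ {P Q} → Step P Q → ℂ
  stepWt diag            = 1ℂ
  stepWt (level {b = b}) = - (conj α[ b -1] / conj (α b) ⟨ conj-NonZero (α≢0 b) ⟩)
  -- from height b + 1, so the indices are (b + 1) - 2 and (b + 1) - 1
  stepWt (down {b = b})  =
    conj α[ b -1] / conj (α b) ⟨ conj-NonZero (α≢0 b) ⟩ * fromℝ (1ℝ -ℝ ∣ α b ∣ *ℝ ∣ α b ∣)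

  wt : ∀ {P Q} → Path P Q → ℂ
  wt = fold (λ _ _ → ℂ) (λ st w → stepWt st * w) 1ℂ

  ΣSch : (n r s : ℕ) → ℂ
  ΣSch n r s = foldr _+_ 0ℂ (List.map wt (Sch n r s))

{-# OPTIONS --safe #-}

-- Write Φ*ₙ for the reversed polynomial and h for ⟪Φₛ,Φₛ⟫.  The Szegő recurrences
--   Φₙ₊₁ = zΦₙ − ᾱₙΦ*ₙ,   Φ*ₙ₊₁ = Φ*ₙ − αₙzΦₙ
-- combine to Φ*ₙ₊₁ = (1 − |αₙ|²)Φ*ₙ − αₙΦₙ₊₁.  Hence Pᵣ = −Φ*ᵣ/αᵣ₋₁ satisfies
--   P₀ = Φ₀,   Pᵣ₊₁ = Φᵣ₊₁ + d̄ᵣ₊₁Pᵣ,   zΦᵣ = Pᵣ₊₁ + l̄ᵣPᵣ,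
-- where dᵣ and lᵣ are the weights of a down and a level step from height r.
-- Paired with Φₛ these are exactly the first-step recursions for the weighted
-- counts of all Schröder paths (Pᵣ) and of those not starting down (Φᵣ), so
--   ⟪Φₛ,zⁿΦᵣ⟫ = h Σ_{Sch} wt   and   ⟪Φₛ,zⁿPᵣ⟫ = h Σ_{all paths} wt
-- by induction on (n, r).  Finally h = ∏_{j<s} (1 − |αⱼ|²) > 0.

module Submission where

open import Defs
open import Algebra.Bundles using (CommutativeRing)
import Algebra.Module.Morphism.Structures as ModuleMorphisms
import Algebra.Properties.AbelianGroup as AbelianGroupProperties
import Algebra.Properties.Group as GroupProperties
import Algebra.Properties.Ring as RingProperties
import Algebra.Properties.Semiring.Mult.TCOptimised as SemiringMult
import Algebra.Solver.Ring as RingSolver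
open import Algebra.Solver.Ring.AlmostCommutativeRing
  using (fromCommutativeRing; _-Raw-AlmostCommutative⟶_)
open import Data.Empty using (⊥-elim)
open import Data.Integer.Base as ℤ using (ℤ; +_; -[1+_]; 0ℤ; 1ℤ)
import Data.Integer.Properties as ℤₚ
import Data.Integer.Solver as ℤSolver
open import Data.List.Base as List using (List; []; _∷_; _++_; filter; foldr)
open import Data.List.Properties
  using (filter-++; filter-all; filter-none; ++-identityʳ; ++-assoc)
open import Data.List.Relation.Unary.All as All using (All)
import Data.List.Relation.Unary.All.Properties as All
open import Data.Maybe.Base using (Maybe; just; nothing)
open import Data.Nat.Base as ℕ using (ℕ; zero; suc)
import Data.Nat.Properties as ℕₚ
open import Data.Product.Base using (_×_; _,_; proj₁; proj₂; Σ-syntax)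
import Data.Product.Properties as Prod
open import Function.Base using (_∘_)
open import Level using (_⊔_)
open import Relation.Binary.Construct.Closure.ReflexiveTransitive using (_◅_)
import Relation.Binary.Reasoning.Setoid as SetoidReasoning
open import Relation.Binary.PropositionalEquality as ≡ using (_≡_; _≢_)
open import Relation.Nullary using (¬_; yes; no; ¬?)

-- Ring solving with integer coefficients over a commutative ring.

module IntegerCoefficients {c ℓ} (K : CommutativeRing c ℓ) where
  open CommutativeRing K
  open RingProperties ring using (-0#≈0#; -‿involutive; -‿distribˡ-*; -‿distribʳ-*)
  open AbelianGroupProperties +-abelianGroup using () renaming (⁻¹-∙-comm to -‿+-comm)
  open SemiringMult semiring using (1+×; ×-homo-+; ×1-homo-*) renaming (_×_ to _·_)
  open SetoidReasoning setoid

  ⟦_⟧ : ℤ → Carrier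
  ⟦ + n ⟧      = n · 1#
  ⟦ -[1+ n ] ⟧ = - (suc n · 1#)

  ⊖-homo : ∀ m n → ⟦ m ℤ.⊖ n ⟧ ≈ m · 1# - n · 1#
  ⊖-homo zero    zero    = sym (-‿inverseʳ 0#)
  ⊖-homo zero    (suc n) = sym (+-identityˡ _)
  ⊖-homo (suc m) zero    = sym (trans (+-congˡ -0#≈0#) (+-identityʳ _))
  ⊖-homo (suc m) (suc n) = begin
    ⟦ suc m ℤ.⊖ suc n ⟧                    ≡⟨ ≡.cong ⟦_⟧ (ℤₚ.[1+m]⊖[1+n]≡m⊖n m n) ⟩
    ⟦ m ℤ.⊖ n ⟧                            ≈⟨ ⊖-homo m n ⟩
    m · 1# - n · 1#                        ≈⟨ +-congʳ (+-identityˡ _) ⟨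
    -- The pair 1 - 1 is inserted so that one 1 can join each of the two counts.
    (0# + m · 1#) - n · 1#                 ≈⟨ +-congʳ (+-congʳ (-‿inverseʳ 1#)) ⟨
    ((1# - 1#) + m · 1#) - n · 1#          ≈⟨ +-congʳ (+-assoc _ _ _) ⟩
    (1# + (- 1# + m · 1#)) - n · 1#        ≈⟨ +-congʳ (+-congˡ (+-comm _ _)) ⟩
    (1# + (m · 1# - 1#)) - n · 1#          ≈⟨ +-congʳ (+-assoc _ _ _) ⟨
    ((1# + m · 1#) - 1#) - n · 1#          ≈⟨ +-assoc _ _ _ ⟩
    (1# + m · 1#) + (- 1# - n · 1#)        ≈⟨ +-congˡ (-‿+-comm _ _) ⟩
    (1# + m · 1#) - (1# + n · 1#)          ≈⟨ +-cong (1+× m 1#) (-‿cong (1+× n 1#)) ⟨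
    suc m · 1# - suc n · 1#                ∎

  +-homo : ∀ i j → ⟦ i ℤ.+ j ⟧ ≈ ⟦ i ⟧ + ⟦ j ⟧
  +-homo (+ m)    (+ n)    = ×-homo-+ 1# m n
  +-homo (+ m)    -[1+ n ] = ⊖-homo m (suc n)
  +-homo -[1+ m ] (+ n)    = trans (⊖-homo n (suc m)) (+-comm _ _)
  +-homo -[1+ m ] -[1+ n ] = begin
    - (suc (suc (m ℕ.+ n)) · 1#)      ≡⟨ ≡.cong (λ k → - (suc k · 1#)) (ℕₚ.+-suc m n) ⟨
    - ((suc m ℕ.+ suc n) · 1#)        ≈⟨ -‿cong (×-homo-+ 1# (suc m) (suc n)) ⟩
    - (suc m · 1# + suc n · 1#)       ≈⟨ -‿+-comm _ _ ⟨
    - (suc m · 1#) - suc n · 1#       ∎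

  -‿homo : ∀ i → ⟦ ℤ.- i ⟧ ≈ - ⟦ i ⟧
  -‿homo (+ zero)  = sym -0#≈0#
  -‿homo (+ suc n) = refl
  -‿homo -[1+ n ]  = sym (-‿involutive _)

  *-homo-pos : ∀ i n → ⟦ i ℤ.* + n ⟧ ≈ ⟦ i ⟧ * ⟦ + n ⟧
  *-homo-pos (+ m)    n = trans (reflexive (≡.cong ⟦_⟧ (≡.sym (ℤₚ.pos-* m n)))) (×1-homo-* m n)
  *-homo-pos -[1+ m ] n = begin
    ⟦ -[1+ m ] ℤ.* + n ⟧        ≡⟨ ≡.cong ⟦_⟧ (ℤₚ.neg-distribˡ-* (+ suc m) (+ n)) ⟨
    ⟦ ℤ.- (+ suc m ℤ.* + n) ⟧   ≈⟨ -‿homo (+ suc m ℤ.* + n) ⟩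
    - ⟦ + suc m ℤ.* + n ⟧       ≈⟨ -‿cong (*-homo-pos (+ suc m) n) ⟩
    - (⟦ + suc m ⟧ * ⟦ + n ⟧)   ≈⟨ -‿distribˡ-* _ _ ⟩
    ⟦ -[1+ m ] ⟧ * ⟦ + n ⟧      ∎

  *-homo : ∀ i j → ⟦ i ℤ.* j ⟧ ≈ ⟦ i ⟧ * ⟦ j ⟧
  *-homo i (+ n)    = *-homo-pos i n
  *-homo i -[1+ n ] = begin
    ⟦ i ℤ.* -[1+ n ] ⟧          ≡⟨ ≡.cong ⟦_⟧ (ℤₚ.neg-distribʳ-* i (+ suc n)) ⟨
    ⟦ ℤ.- (i ℤ.* + suc n) ⟧     ≈⟨ -‿homo (i ℤ.* + suc n) ⟩
    - ⟦ i ℤ.* + suc n ⟧         ≈⟨ -‿cong (*-homo-pos i (suc n)) ⟩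
    - (⟦ i ⟧ * ⟦ + suc n ⟧)     ≈⟨ -‿distribʳ-* _ _ ⟩
    ⟦ i ⟧ * ⟦ -[1+ n ] ⟧        ∎

  homomorphism : ℤ.+-*-rawRing -Raw-AlmostCommutative⟶ fromCommutativeRing K
  homomorphism = record
    { ⟦_⟧ = ⟦_⟧ ; +-homo = +-homo ; *-homo = *-homo ; -‿homo = -‿homo
    ; 0-homo = refl ; 1-homo = refl }

  -- The solver needs only a sound test. `nothing` claims no inequality, since distinct integers can
  -- have equal images in a ring of positive characteristic.
  ≟-weak : ∀ i j → Maybe (⟦ i ⟧ ≈ ⟦ j ⟧)
  ≟-weak i j with i ℤₚ.≟ j
  ... | yes ≡.refl = just refl
  ... | no  _      = nothing

  open RingSolver ℤ.+-*-rawRing (fromCommutativeRing K) homomorphism ≟-weak public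
    using (solve; _:=_; _:+_; _:*_; _:-_; :-_; con)

-- Ring identities behind the path recursions and the norms.

module RingIdentities {c ℓ} (K : CommutativeRing c ℓ) where
  open CommutativeRing K
  open IntegerCoefficients K
  open SetoidReasoning setoid

  -- In the level and down steps x = ⟪Φₛ,zⁿΦᵣ⟫ and y = ⟪Φₛ,zⁿΦ*ᵣ⟫ for suitable n and r,
  -- β = ᾱᵣ, γ = 1/ᾱᵣ, b = ᾱᵣ₋₁ and ρ = 1 − |αᵣ|².
  level-step : ∀ {β γ b h f₀ f₁ x y₀ y₁} → β * γ ≈ 1# →
               y₁ ≈ y₀ - β * x → y₀ ≈ - (b * (h * f₀)) → y₁ ≈ - (β * (h * f₁)) →
               x ≈ h * (1# * f₁ + - (b * γ) * f₀)
  level-step {β} {γ} {b} {h} {f₀} {f₁} {x} {y₀} {y₁} βγ≈1 y₁≈ y₀≈ y₁≈′ = begin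
    x                                           ≈⟨ *-identityˡ x ⟨
    1# * x                                      ≈⟨ *-congʳ βγ≈1 ⟨
    -- The pairing with zΦᵣ is recovered from two consecutive reversed polynomials: y₀ - y₁ is βx,
    -- and γ undoes β.
    β * γ * x
      ≈⟨ solve 4 (λ β γ x y → β :* γ :* x := γ :* (y :- (y :- β :* x))) refl β γ x y₀ ⟩
    γ * (y₀ - (y₀ - β * x))                     ≈⟨ *-congˡ (+-congˡ (-‿cong y₁≈)) ⟨
    γ * (y₀ - y₁)                               ≈⟨ *-congˡ (+-cong y₀≈ (-‿cong y₁≈′)) ⟩
    γ * (- (b * (h * f₀)) - - (β * (h * f₁)))
      ≈⟨ solve 6 (λ β γ b h f₀ f₁ →
           γ :* (:- (b :* (h :* f₀)) :- :- (β :* (h :* f₁))) :=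
           h :* (β :* γ :* f₁ :+ :- (b :* γ) :* f₀)) refl β γ b h f₀ f₁ ⟩
    h * (β * γ * f₁ + - (b * γ) * f₀)           ≈⟨ *-congˡ (+-congʳ (*-congʳ βγ≈1)) ⟩
    h * (1# * f₁ + - (b * γ) * f₀)              ∎

  -- Eliminates x through x = x′ + αy. It serves both slots of the form; passing from one slot to
  -- the other exchanges αᵣ and ᾱᵣ.
  star-step : ∀ {α β ρ x x′ y y′} → y′ ≈ y - β * x → x′ ≈ x - α * y → ρ ≈ 1# - β * α →
              y′ ≈ ρ * y - β * x′
  star-step {α} {β} {ρ} {x} {x′} {y} {y′} y′≈ x′≈ ρ≈ = begin
    y′                                  ≈⟨ y′≈ ⟩
    y - β * x
      ≈⟨ solve 4 (λ α β x y →
           y :- β :* x :=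
           (con 1ℤ :- β :* α) :* y :- β :* (x :- α :* y)) refl α β x y ⟩
    (1# - β * α) * y - β * (x - α * y)  ≈⟨ +-cong (*-congʳ ρ≈) (-‿cong (*-congˡ x′≈)) ⟨
    ρ * y - β * x′                      ∎

  down-step : ∀ {β γ ρ b h s f x y y′} → β * γ ≈ 1# → y′ ≈ ρ * y - β * x →
              y ≈ - (b * (h * f)) → x ≈ h * s →
              y′ ≈ - (β * (h * (s + b * γ * ρ * f)))
  down-step {β} {γ} {ρ} {b} {h} {s} {f} {x} {y} {y′} βγ≈1 y′≈ y≈ x≈ = begin
    y′                                        ≈⟨ y′≈ ⟩
    ρ * y - β * x                             ≈⟨ +-cong (*-congˡ y≈) (-‿cong (*-congˡ x≈)) ⟩
    -- Only the second term carries β. Writing 1 as βγ supplies β in the first and leaves behind the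
    -- down weight bγρ.
    ρ * - (b * (h * f)) - β * (h * s)         ≈⟨ +-congʳ (*-identityˡ _) ⟨
    1# * (ρ * - (b * (h * f))) - β * (h * s)  ≈⟨ +-congʳ (*-congʳ βγ≈1) ⟨
    β * γ * (ρ * - (b * (h * f))) - β * (h * s)
      ≈⟨ solve 7 (λ β γ ρ b h s f →
           β :* γ :* (ρ :* :- (b :* (h :* f))) :- β :* (h :* s) :=
           :- (β :* (h :* (s :+ b :* γ :* ρ :* f)))) refl β γ ρ b h s f ⟩
    - (β * (h * (s + b * γ * ρ * f)))         ∎

  -- h = ⟪Φ′,Φ′⟫ and k′ = ⟪Φ′*,Φ′*⟫ for the successors Φ′, Φ′* of Φ, Φ*, while
  -- u = ⟪zΦ,zΦ⟫, v = ⟪zΦ,Φ*⟫, w = ⟪Φ*,zΦ⟫ and k = ⟪Φ*,Φ*⟫.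
  orthogonal-norm : ∀ {α β N a b h u v k} → h ≈ a - β * b → b ≈ 0# → a ≈ u - α * v →
                    v ≈ β * k → u ≈ N → k ≈ N → h ≈ (1# - β * α) * N
  orthogonal-norm {α} {β} {N} {a} {b} {h} {u} {v} {k} h≈ b≈0 a≈ v≈ u≈N k≈N = begin
    h                                ≈⟨ h≈ ⟩
    a - β * b                        ≈⟨ +-cong a≈ (-‿cong (*-congˡ b≈0)) ⟩
    (u - α * v) - β * 0#
      ≈⟨ +-congʳ (+-cong u≈N (-‿cong (*-congˡ (trans v≈ (*-congˡ k≈N))))) ⟩
    (N - α * (β * N)) - β * 0#
      ≈⟨ solve 3 (λ α β N →
           (N :- α :* (β :* N)) :- β :* con 0ℤ :=
           (con 1ℤ :- β :* α) :* N) refl α β N ⟩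
    (1# - β * α) * N                 ∎

  star-norm : ∀ {α β N a b k′ k u v w} → k′ ≈ a - α * b → a ≈ k - β * w → w ≈ α * k →
              b ≈ v - β * u → v ≈ β * k → u ≈ N → k ≈ N → k′ ≈ (1# - β * α) * N
  star-norm {α} {β} {N} {a} {b} {k′} {k} {u} {v} {w} k′≈ a≈ w≈ b≈ v≈ u≈N k≈N = begin
    k′                                               ≈⟨ k′≈ ⟩
    a - α * b                                        ≈⟨ +-cong a≈ (-‿cong (*-congˡ b≈)) ⟩
    (k - β * w) - α * (v - β * u)
      ≈⟨ +-cong (+-cong k≈N (-‿cong (*-congˡ (trans w≈ (*-congˡ k≈N)))))
                (-‿cong (*-congˡ (+-cong (trans v≈ (*-congˡ k≈N)) (-‿cong (*-congˡ u≈N))))) ⟩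
    (N - β * (α * N)) - α * (β * N - β * N)
      ≈⟨ solve 3 (λ α β N →
           (N :- β :* (α :* N)) :- α :* (β :* N :- β :* N) :=
           (con 1ℤ :- β :* α) :* N) refl α β N ⟩
    (1# - β * α) * N                                 ∎

  combine-zero : ∀ ρ β {x y} → x ≈ 0# → y ≈ 0# → ρ * x - β * y ≈ 0#
  combine-zero ρ β x≈0 y≈0 = trans (+-cong (*-congˡ x≈0) (-‿cong (*-congˡ y≈0)))
    (solve 2 (λ ρ β → ρ :* con 0ℤ :- β :* con 0ℤ := con 0ℤ) refl ρ β)

  neg-* : ∀ a x → - (a * x) ≈ - a * x
  neg-* = solve 2 (λ a x → :- (a :* x) := :- a :* x) refl

  neg-neg-1* : ∀ x → x ≈ - (- 1# * x)
  neg-neg-1* = solve 1 (λ x → x := :- (:- con 1ℤ :* x)) refl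

  cancel : ∀ {x y z} → x * z ≈ 1# → x * y * z ≈ y
  cancel {x} {y} {z} xz≈1 = begin
    x * y * z    ≈⟨ solve 3 (λ x y z → x :* y :* z := x :* z :* y) refl x y z ⟩
    x * z * y    ≈⟨ *-congʳ xz≈1 ⟩
    1# * y       ≈⟨ *-identityˡ y ⟩
    y            ∎

  neg-*+ : ∀ b t x → - b * t + - x ≈ - (b * t + x)
  neg-*+ = solve 3 (λ b t x → :- b :* t :+ :- x := :- (b :* t :+ x)) refl

  *-interchange : ∀ a t u x y → a * (t + u) + (x + y) ≈ (a * t + x) + (a * u + y)
  *-interchange = solve 5 (λ a t u x y →
    a :* (t :+ u) :+ (x :+ y) := (a :* t :+ x) :+ (a :* u :+ y)) refl

  *-pull : ∀ a b t x → b * (a * t) + a * x ≈ a * (b * t + x)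
  *-pull = solve 4 (λ a b t x → b :* (a :* t) :+ a :* x := a :* (b :* t :+ x)) refl

-- Complex numbers: ring structure, conjugation and modulus.

module ComplexProperties {c ℓ₁ ℓ₂} (R : Reals c ℓ₁ ℓ₂) where
  open Complex R
  private
    module ℝ where
      open CommutativeRing (Reals.commutativeRing R) public
      open RingProperties ring public using (-‿involutive; -0#≈0#)
      open AbelianGroupProperties +-abelianGroup public
        using () renaming (⁻¹-∙-comm to -‿+-comm)
  open IntegerCoefficients (Reals.commutativeRing R)

  ℂ-commutativeRing : CommutativeRing c ℓ₁
  ℂ-commutativeRing = record
    { Carrier = ℂ ; _≈_ = _≈_ ; _+_ = _+_ ; _*_ = _*_ ; -_ = -_ ; 0# = 0ℂ ; 1# = 1ℂ
    ; isCommutativeRing = record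
      { isRing = record
        { +-isAbelianGroup = record
          { isGroup = record
            { isMonoid = record
              { isSemigroup = record
                { isMagma = record
                  { isEquivalence = record
                    { refl  = ℝ.refl , ℝ.refl
                    ; sym   = λ (p , q) → ℝ.sym p , ℝ.sym q
                    ; trans = λ (p , q) (p′ , q′) → ℝ.trans p p′ , ℝ.trans q q′ }
                  ; ∙-cong = λ (p , q) (p′ , q′) → ℝ.+-cong p p′ , ℝ.+-cong q q′ }
                ; assoc = λ x y z → ℝ.+-assoc _ _ _ , ℝ.+-assoc _ _ _ }
              ; identity = (λ x → ℝ.+-identityˡ _ , ℝ.+-identityˡ _)
                         , (λ x → ℝ.+-identityʳ _ , ℝ.+-identityʳ _) }
            ; inverse = (λ x → ℝ.-‿inverseˡ _ , ℝ.-‿inverseˡ _)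
                      , (λ x → ℝ.-‿inverseʳ _ , ℝ.-‿inverseʳ _)
            ; ⁻¹-cong = λ (p , q) → ℝ.-‿cong p , ℝ.-‿cong q }
          ; comm = λ x y → ℝ.+-comm _ _ , ℝ.+-comm _ _ }
        ; *-cong = λ (p , q) (p′ , q′) →
            ℝ.+-cong (ℝ.*-cong p p′) (ℝ.-‿cong (ℝ.*-cong q q′)) ,
            ℝ.+-cong (ℝ.*-cong p q′) (ℝ.*-cong q p′)
        ; *-assoc = λ (a +i b) (c +i d) (e +i f) →
            solve 6 (λ a b c d e f →
              (a :* c :- b :* d) :* e :- (a :* d :+ b :* c) :* f :=
              a :* (c :* e :- d :* f) :- b :* (c :* f :+ d :* e)) ℝ.refl a b c d e f ,
            solve 6 (λ a b c d e f →
              (a :* c :- b :* d) :* f :+ (a :* d :+ b :* c) :* e :=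
              a :* (c :* f :+ d :* e) :+ b :* (c :* e :- d :* f)) ℝ.refl a b c d e f
        ; *-identity =
            (λ (a +i b) →
              solve 2 (λ a b → con 1ℤ :* a :- con 0ℤ :* b := a) ℝ.refl a b ,
              solve 2 (λ a b → con 1ℤ :* b :+ con 0ℤ :* a := b) ℝ.refl a b) ,
            (λ (a +i b) →
              solve 2 (λ a b → a :* con 1ℤ :- b :* con 0ℤ := a) ℝ.refl a b ,
              solve 2 (λ a b → a :* con 0ℤ :+ b :* con 1ℤ := b) ℝ.refl a b)
        ; distrib =
            (λ (a +i b) (c +i d) (e +i f) →
              solve 6 (λ a b c d e f → a :* (c :+ e) :- b :* (d :+ f) :=
                (a :* c :- b :* d) :+ (a :* e :- b :* f)) ℝ.refl a b c d e f ,
              solve 6 (λ a b c d e f → a :* (d :+ f) :+ b :* (c :+ e) :=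
                (a :* d :+ b :* c) :+ (a :* f :+ b :* e)) ℝ.refl a b c d e f) ,
            (λ (a +i b) (c +i d) (e +i f) →
              solve 6 (λ a b c d e f → (c :+ e) :* a :- (d :+ f) :* b :=
                (c :* a :- d :* b) :+ (e :* a :- f :* b)) ℝ.refl a b c d e f ,
              solve 6 (λ a b c d e f → (c :+ e) :* b :+ (d :+ f) :* a :=
                (c :* b :+ d :* a) :+ (e :* b :+ f :* a)) ℝ.refl a b c d e f) }
      ; *-comm = λ (a +i b) (c +i d) →
          solve 4 (λ a b c d → a :* c :- b :* d := c :* a :- d :* b) ℝ.refl a b c d ,
          solve 4 (λ a b c d → a :* d :+ b :* c := c :* b :+ d :* a) ℝ.refl a b c d } }

  open CommutativeRing ℂ-commutativeRing using (sym; trans; *-congʳ; *-assoc)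

  -0≈0 : - 0ℂ ≈ 0ℂ
  -0≈0 = ℝ.-0#≈0# , ℝ.-0#≈0#

  conj-cong : ∀ {z w} → z ≈ w → conj z ≈ conj w
  conj-cong (p , q) = p , ℝ.-‿cong q

  conj-involutive : ∀ z → conj (conj z) ≈ z
  conj-involutive z = ℝ.refl , ℝ.-‿involutive _

  conj-0 : conj 0ℂ ≈ 0ℂ
  conj-0 = ℝ.refl , ℝ.-0#≈0#

  conj-1 : conj 1ℂ ≈ 1ℂ
  conj-1 = ℝ.refl , ℝ.-0#≈0#

  conj-+ : ∀ z w → conj (z + w) ≈ conj z + conj w
  conj-+ z w = ℝ.refl , ℝ.sym (ℝ.-‿+-comm _ _)

  conj-neg : ∀ z → conj (- z) ≈ - conj z
  conj-neg z = ℝ.refl , ℝ.refl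

  conj-* : ∀ z w → conj (z * w) ≈ conj z * conj w
  conj-* (a +i b) (c +i d) =
    solve 4 (λ a b c d → a :* c :- b :* d := a :* c :- :- b :* :- d) ℝ.refl a b c d ,
    solve 4 (λ a b c d → :- (a :* d :+ b :* c) := a :* :- d :+ :- b :* c) ℝ.refl a b c d

  fromℝ-* : ∀ x y → fromℝ (x ℝ.* y) ≈ fromℝ x * fromℝ y
  fromℝ-* x y =
    solve 2 (λ x y → x :* y := x :* y :- con 0ℤ :* con 0ℤ) ℝ.refl x y ,
    solve 2 (λ x y → con 0ℤ := x :* con 0ℤ :+ con 0ℤ :* y) ℝ.refl x y

  z*conj[z] : ∀ z → z * conj z ≈ fromℝ (normSq z)
  z*conj[z] (a +i b) =
    solve 2 (λ a b → a :* a :- b :* :- b := a :* a :+ b :* b) ℝ.refl a b ,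
    solve 2 (λ a b → a :* :- b :+ b :* a := con 0ℤ) ℝ.refl a b

  -- The product of z and z̄ is the real number |z|², which the second factor of `reciprocal`
  -- inverts.
  *-reciprocal : ∀ z (nz : NonZero z) → z * reciprocal z nz ≈ 1ℂ
  *-reciprocal z nz =
    trans (sym (*-assoc z (conj z) (fromℝ (proj₁ (1/normSq z nz)))))
      (trans (*-congʳ (z*conj[z] z))
        (trans (sym (fromℝ-* (normSq z) (proj₁ (1/normSq z nz)))) (proj₂ (1/normSq z nz) , ℝ.refl)))

  -- Links the step weights, written with the modulus, to the factor 1 - ᾱα that the recurrences
  -- produce.
  1-conj[z]*z : ∀ z → fromℝ (1ℝ ℝ.- ∣ z ∣ ℝ.* ∣ z ∣) ≈ 1ℂ - conj z * z
  1-conj[z]*z z@(a +i b) =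
    ℝ.trans (ℝ.+-congˡ (ℝ.-‿cong (∣∣²≈normSq z)))
      (solve 2 (λ a b → con 1ℤ :- (a :* a :+ b :* b) :=
                        con 1ℤ :- (a :* a :- :- b :* b)) ℝ.refl a b) ,
    solve 2 (λ a b → con 0ℤ := con 0ℤ :- (a :* b :+ :- b :* a)) ℝ.refl a b

-- Laurent polynomials tested by linear functionals.

module Evaluation {c ℓ₁ ℓ₂} (R : Reals c ℓ₁ ℓ₂) where
  open Complex R
  open Laurent R
  open ComplexProperties R
  open CommutativeRing ℂ-commutativeRing
    using (setoid; refl; sym; trans; reflexive; +-cong; +-congˡ; +-congʳ; *-congˡ; -‿cong;
           +-identityˡ; +-identityʳ; *-identityˡ; *-identityʳ; zeroʳ; +-assoc; *-assoc;
           distribˡ)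
  open SetoidReasoning setoid
  private module Id = RingIdentities ℂ-commutativeRing

  infix 4 _≃_

  -- This is the linear functional with value `T k` on zᵏ. It reads a formal sum term by term, so
  -- repeated exponents need no merging.
  ev : (ℤ → ℂ) → LaurentPoly → ℂ
  ev T []            = 0ℂ
  ev T ((k , a) ∷ f) = a * T k + ev T f

  -- Comparing Laurent polynomials by all linear functionals zᵏ ↦ T k avoids
  -- computing coefficients of products and substitutions.
  record _≃_ (f g : LaurentPoly) : Set (c ⊔ ℓ₁) where
    constructor mk≃
    field ev-≈ : ∀ T → ev T f ≈ ev T g

  open _≃_ public

  ≃-trans : ∀ {f g h} → f ≃ g → g ≃ h → f ≃ h
  ≃-trans f≃g g≃h = mk≃ λ T → trans (ev-≈ f≃g T) (ev-≈ g≃h T)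

  ev-cong : ∀ {T U} → (∀ k → T k ≈ U k) → ∀ f → ev T f ≈ ev U f
  ev-cong T≈U []            = refl
  ev-cong T≈U ((k , a) ∷ f) = +-cong (*-congˡ {a} (T≈U k)) (ev-cong T≈U f)

  ev-⊕ : ∀ T f g → ev T (f ⊕ g) ≈ ev T f + ev T g
  ev-⊕ T []            g = sym (+-identityˡ (ev T g))
  ev-⊕ T ((k , a) ∷ f) g = trans (+-congˡ (ev-⊕ T f g)) (sym (+-assoc (a * T k) (ev T f) (ev T g)))

  ev-• : ∀ T a f → ev T (a • f) ≈ a * ev T f
  ev-• T a []            = sym (zeroʳ a)
  ev-• T a ((k , b) ∷ f) = trans (+-cong (*-assoc a b (T k)) (ev-• T a f))
                                 (sym (distribˡ a (b * T k) (ev T f)))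

  ev-⊖ : ∀ T f → ev T (⊖ f) ≈ - ev T f
  ev-⊖ T []            = sym -0≈0
  ev-⊖ T ((k , b) ∷ f) = trans (+-congˡ (ev-⊖ T f)) (Id.neg-*+ b (T k) (ev T f))

  ev-⊖• : ∀ T f a g → ev T (f ⊖ a • g) ≈ ev T f - a * ev T g
  ev-⊖• T f a g = trans (ev-⊕ T f (⊖ (a • g)))
    (+-congˡ (trans (ev-⊖ T (a • g)) (-‿cong (ev-• T a g))))

  ev-at-1/z : ∀ T f → ev T (f at-1/z) ≡ ev (λ k → T (ℤ.- k)) f
  ev-at-1/z T []            = ≡.refl
  ev-at-1/z T ((k , a) ∷ f) = ≡.cong (λ w → a * T (ℤ.- k) + w) (ev-at-1/z T f)

  ev-conjCoeff : ∀ T f → ev T (conjCoeff f) ≈ conj (ev (λ k → conj (T k)) f)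
  ev-conjCoeff T []            = sym conj-0
  ev-conjCoeff T ((k , a) ∷ f) = sym (trans (conj-+ (a * conj (T k)) _)
    (+-cong (trans (conj-* a (conj (T k))) (*-congˡ {conj a} (conj-involutive (T k))))
            (sym (ev-conjCoeff T f))))

  ev-+ : ∀ T U f → ev (λ k → T k + U k) f ≈ ev T f + ev U f
  ev-+ T U []            = sym (+-identityˡ 0ℂ)
  ev-+ T U ((k , a) ∷ f) = trans (+-congˡ (ev-+ T U f))
    (Id.*-interchange a (T k) (U k) (ev T f) (ev U f))

  ev-* : ∀ a T f → ev (λ k → a * T k) f ≈ a * ev T f
  ev-* a T []            = sym (zeroʳ a)
  ev-* a T ((k , b) ∷ f) = trans (+-congˡ (ev-* a T f)) (Id.*-pull a b (T k) (ev T f))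

  -- By bilinearity and zʲzᵏ = zʲ⁺ᵏ, a product can be tested one factor at a time. Identities
  -- between products then reduce to identities between exponents.
  ev-⊗ : ∀ T f g → ev T (f ⊗ g) ≈ ev (λ j → ev (λ k → T (j ℤ.+ k)) g) f
  ev-⊗ T []            g = refl
  ev-⊗ T ((j , a) ∷ f) g =
    trans (ev-⊕ T (List.map (λ (k , b) → j ℤ.+ k , a * b) g) (f ⊗ g)) (+-cong (term g) (ev-⊗ T f g))
    where
    term : ∀ g → ev T (List.map (λ (k , b) → j ℤ.+ k , a * b) g) ≈ a * ev (λ k → T (j ℤ.+ k)) g
    term []            = sym (zeroʳ a)
    term ((k , b) ∷ g) = trans (+-cong (*-assoc a b (T (j ℤ.+ k))) (term g))
                               (sym (distribˡ a (b * T (j ℤ.+ k)) (ev (λ k → T (j ℤ.+ k)) g)))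

  ev-z^ : ∀ T i f → ev T (z^ i ⊗ f) ≈ ev (λ k → T (i ℤ.+ k)) f
  ev-z^ T i f = trans (ev-⊗ T (z^ i) f) (trans (+-identityʳ _) (*-identityˡ _))

  z^0⊗ : ∀ f → z^ 0ℤ ⊗ f ≃ f
  z^0⊗ f = mk≃ λ T → trans (ev-z^ T 0ℤ f)
    (ev-cong (λ k → reflexive (≡.cong T (ℤₚ.+-identityˡ k))) f)

  -- The recurrences produce zⁿ(zΦᵣ), while the induction is phrased with zⁿ⁺¹Φᵣ.
  z^suc⊗ : ∀ n f → z^ (+ suc n) ⊗ f ≃ z^ (+ n) ⊗ (z^ 1ℤ ⊗ f)
  z^suc⊗ n f = mk≃ λ T → trans (ev-z^ T (+ suc n) f) (trans
    (ev-cong (λ k → reflexive (≡.cong T (move-1 (+ n) k))) f)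
    (sym (trans (ev-z^ T (+ n) (z^ 1ℤ ⊗ f)) (ev-z^ (λ k → T (+ n ℤ.+ k)) 1ℤ f))))
    where
    open ℤSolver.+-*-Solver
    move-1 : ∀ n k → 1ℤ ℤ.+ n ℤ.+ k ≡ n ℤ.+ (1ℤ ℤ.+ k)
    move-1 = solve 2 (λ n k → con 1ℤ :+ n :+ k := n :+ (con 1ℤ :+ k)) ≡.refl

  ⊗-congˡ : ∀ i {f g} → f ≃ g → z^ i ⊗ f ≃ z^ i ⊗ g
  ⊗-congˡ i {f} {g} f≃g = mk≃ λ T →
    trans (ev-z^ T i f) (trans (ev-≈ f≃g (λ k → T (i ℤ.+ k))) (sym (ev-z^ T i g)))

  ⊗-⊖• : ∀ i f a g → z^ i ⊗ (f ⊖ a • g) ≃ z^ i ⊗ f ⊖ a • (z^ i ⊗ g)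
  ⊗-⊖• i f a g = mk≃ λ T → trans (ev-z^ T i (f ⊖ a • g))
    (trans (ev-⊖• (λ k → T (i ℤ.+ k)) f a g)
      (sym (trans (ev-⊖• T (z^ i ⊗ f) a (z^ i ⊗ g))
        (+-cong (ev-z^ T i f) (-‿cong (*-congˡ {a} (ev-z^ T i g)))))))

  -- A formal sum is a combination of monomials, each term agreeing with a multiple of `z^ k` up to
  -- `≋`. Respect of 𝓛 for `≋` enters here; afterwards pairings can be compared through `≃`.
  linear≈ev : ∀ {𝓛} → IsLinear 𝓛 → ∀ f → 𝓛 f ≈ ev (λ k → 𝓛 (z^ k)) f
  linear≈ev {𝓛} lin = go
    where
    open ModuleMorphisms.LeftModuleMorphisms.IsLeftModuleHomomorphism lin

    term : ∀ k a → List.[ (k , a) ] ≋ a • z^ k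
    term k a j with k ℤₚ.≟ j
    ... | yes _ = +-congʳ (sym (*-identityʳ a))
    ... | no  _ = refl

    go : ∀ f → 𝓛 f ≈ ev (λ k → 𝓛 (z^ k)) f
    go []            = 0ᴹ-homo
    go ((k , a) ∷ f) = trans (+ᴹ-homo List.[ (k , a) ] f)
      (+-cong (trans (⟦⟧-cong (term k a)) (*ₗ-homo a (z^ k))) (go f))

-- Reversed polynomials and the Szegő recurrences.

module Szegő {c ℓ₁ ℓ₂} (R : Reals c ℓ₁ ℓ₂) (α : ℕ → Complex.ℂ R) where
  open Complex R
  open Laurent R
  open OrthogonalPolynomials R α
  open ComplexProperties R
  open Evaluation R
  open CommutativeRing ℂ-commutativeRing
    using (setoid; trans; reflexive; +-cong; +-congˡ; *-cong; *-congˡ; -‿cong)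
  open SetoidReasoning setoid

  Φ* : ℕ → LaurentPoly
  Φ* n = Φ n ⋆⟨ n ⟩

  -- Reversal sends azᵏ to āzⁿ⁻ᵏ, so testing the reversal by T amounts to testing the original by
  -- these values and conjugating the result.
  reflect : ℕ → (ℤ → ℂ) → ℤ → ℂ
  reflect n T k = conj (T (+ n ℤ.+ ℤ.- k))

  ev-⋆ : ∀ T f n → ev T (f ⋆⟨ n ⟩) ≈ conj (ev (reflect n T) f)
  ev-⋆ T f n = trans (ev-z^ T (+ n) ((conjCoeff f) at-1/z))
    (trans (reflexive (ev-at-1/z (λ k → T (+ n ℤ.+ k)) (conjCoeff f)))
      (ev-conjCoeff (λ k → T (+ n ℤ.+ ℤ.- k)) f))

  ⋆-involutive : ∀ n f → (f ⋆⟨ n ⟩) ⋆⟨ n ⟩ ≃ f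
  ⋆-involutive n f = mk≃ λ T → trans (ev-⋆ T (f ⋆⟨ n ⟩) n)
    (trans (conj-cong (ev-⋆ (reflect n T) f n))
      (trans (conj-involutive _) (ev-cong (λ k → trans (conj-involutive _)
        (reflexive (≡.cong T (reflect-twice (+ n) k)))) f)))
    where
    open ℤSolver.+-*-Solver
    reflect-twice : ∀ n k → n ℤ.+ ℤ.- (n ℤ.+ ℤ.- k) ≡ k
    reflect-twice = solve 2 (λ n k → n :+ :- (n :+ :- k) := k) ≡.refl

  ⋆-⊖• : ∀ n f a g → (f ⊖ a • g) ⋆⟨ n ⟩ ≃ f ⋆⟨ n ⟩ ⊖ conj a • g ⋆⟨ n ⟩
  ⋆-⊖• n f a g = mk≃ λ T → begin
    ev T ((f ⊖ a • g) ⋆⟨ n ⟩)                          ≈⟨ ev-⋆ T (f ⊖ a • g) n ⟩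
    conj (ev (reflect n T) (f ⊖ a • g))
      ≈⟨ conj-cong (ev-⊖• (reflect n T) f a g) ⟩
    conj (ev (reflect n T) f - a * ev (reflect n T) g)
      ≈⟨ conj-+ (ev (reflect n T) f) (- (a * ev (reflect n T) g)) ⟩
    conj (ev (reflect n T) f) + conj (- (a * ev (reflect n T) g))
      ≈⟨ +-congˡ (trans (conj-neg (a * ev (reflect n T) g)) (-‿cong (conj-* a (ev (reflect n T) g)))) ⟩
    conj (ev (reflect n T) f) - conj a * conj (ev (reflect n T) g)
      ≈⟨ +-cong (ev-⋆ T f n) (-‿cong (*-congˡ {conj a} (ev-⋆ T g n))) ⟨
    ev T (f ⋆⟨ n ⟩) - conj a * ev T (g ⋆⟨ n ⟩)         ≈⟨ ev-⊖• T (f ⋆⟨ n ⟩) (conj a) (g ⋆⟨ n ⟩) ⟨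
    ev T (f ⋆⟨ n ⟩ ⊖ conj a • g ⋆⟨ n ⟩)                ∎

  z⊗-⋆-suc : ∀ n f → (z^ 1ℤ ⊗ f) ⋆⟨ suc n ⟩ ≃ f ⋆⟨ n ⟩
  z⊗-⋆-suc n f = mk≃ λ T → begin
    ev T ((z^ 1ℤ ⊗ f) ⋆⟨ suc n ⟩)                             ≈⟨ ev-⋆ T (z^ 1ℤ ⊗ f) (suc n) ⟩
    conj (ev (reflect (suc n) T) (z^ 1ℤ ⊗ f))                 ≈⟨ conj-cong (ev-z^ (reflect (suc n) T) 1ℤ f) ⟩
    conj (ev (λ k → conj (T (+ suc n ℤ.+ ℤ.- (1ℤ ℤ.+ k)))) f)
      ≈⟨ conj-cong (ev-cong (λ k → reflexive (≡.cong (conj ∘ T) (cancel-1 (+ n) k))) f) ⟩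
    conj (ev (reflect n T) f)                                 ≈⟨ ev-⋆ T f n ⟨
    ev T (f ⋆⟨ n ⟩)                                           ∎
    where
    open ℤSolver.+-*-Solver
    cancel-1 : ∀ n k → 1ℤ ℤ.+ n ℤ.+ ℤ.- (1ℤ ℤ.+ k) ≡ n ℤ.+ ℤ.- k
    cancel-1 = solve 2 (λ n k → con 1ℤ :+ n :+ :- (con 1ℤ :+ k) := n :+ :- k) ≡.refl

  ⋆-suc : ∀ n f → f ⋆⟨ suc n ⟩ ≃ z^ 1ℤ ⊗ f ⋆⟨ n ⟩
  ⋆-suc n f = mk≃ λ T → begin
    ev T (f ⋆⟨ suc n ⟩)                                    ≈⟨ ev-⋆ T f (suc n) ⟩
    conj (ev (reflect (suc n) T) f)
      ≈⟨ conj-cong (ev-cong (λ k → reflexive (≡.cong (conj ∘ T) (ℤₚ.+-assoc 1ℤ (+ n) (ℤ.- k)))) f) ⟩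
    conj (ev (λ k → conj (T (1ℤ ℤ.+ (+ n ℤ.+ ℤ.- k)))) f)  ≈⟨ ev-⋆ (λ k → T (1ℤ ℤ.+ k)) f n ⟨
    ev (λ k → T (1ℤ ℤ.+ k)) (f ⋆⟨ n ⟩)                     ≈⟨ ev-z^ T 1ℤ (f ⋆⟨ n ⟩) ⟨
    ev T (z^ 1ℤ ⊗ f ⋆⟨ n ⟩)                                ∎

  Φ*-zero : Φ* 0 ≃ Φ 0
  Φ*-zero = mk≃ λ T → trans (ev-⋆ T (Φ 0) 0) (trans (conj-+ (1ℂ * conj (T 0ℤ)) 0ℂ)
    (+-cong (trans (conj-* 1ℂ (conj (T 0ℤ))) (*-cong conj-1 (conj-involutive (T 0ℤ)))) conj-0))

  -- Reverse the definition of Φₙ₊₁ at degree n + 1: zΦₙ becomes Φ*ₙ, and ᾱₙ becomes αₙ. Reversing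
  -- Φ*ₙ at degree n would return Φₙ; the extra degree makes it zΦₙ.
  Φ*-suc : ∀ n → Φ* (suc n) ≃ Φ* n ⊖ α n • (z^ 1ℤ ⊗ Φ n)
  Φ*-suc n = mk≃ λ T → begin
    ev T (Φ (suc n) ⋆⟨ suc n ⟩)
      ≈⟨ ev-≈ (⋆-⊖• (suc n) (z^ 1ℤ ⊗ Φ n) (conj (α n)) (Φ* n)) T ⟩
    ev T ((z^ 1ℤ ⊗ Φ n) ⋆⟨ suc n ⟩ ⊖ conj (conj (α n)) • Φ* n ⋆⟨ suc n ⟩)
      ≈⟨ ev-⊖• T ((z^ 1ℤ ⊗ Φ n) ⋆⟨ suc n ⟩) (conj (conj (α n))) (Φ* n ⋆⟨ suc n ⟩) ⟩
    ev T ((z^ 1ℤ ⊗ Φ n) ⋆⟨ suc n ⟩) - conj (conj (α n)) * ev T (Φ* n ⋆⟨ suc n ⟩)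
      ≈⟨ +-cong (ev-≈ (z⊗-⋆-suc n (Φ n)) T) (-‿cong (*-cong (conj-involutive (α n)) (ev-≈ zΦ T))) ⟩
    ev T (Φ* n) - α n * ev T (z^ 1ℤ ⊗ Φ n)
      ≈⟨ ev-⊖• T (Φ* n) (α n) (z^ 1ℤ ⊗ Φ n) ⟨
    ev T (Φ* n ⊖ α n • (z^ 1ℤ ⊗ Φ n)) ∎
    where
    zΦ : Φ* n ⋆⟨ suc n ⟩ ≃ z^ 1ℤ ⊗ Φ n
    zΦ = ≃-trans (⋆-suc n (Φ* n)) (⊗-congˡ 1ℤ (⋆-involutive n (Φ n)))

-- The sesquilinear form.

module Form {c ℓ₁ ℓ₂} (R : Reals c ℓ₁ ℓ₂) (α : ℕ → Complex.ℂ R)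
            (𝓛 : Laurent.LaurentPoly R → Complex.ℂ R) (linear : Laurent.IsLinear R 𝓛) where
  open Complex R
  open Laurent R
  open OrthogonalPolynomials.Moments R α 𝓛
  open ComplexProperties R
  open Evaluation R
  open CommutativeRing ℂ-commutativeRing
    using (setoid; sym; trans; reflexive; +-cong; +-congˡ; *-congˡ; -‿cong)
  open SetoidReasoning setoid
  private module Id = RingIdentities ℂ-commutativeRing

  -- This is the pairing of zʲ with g, written through the values of 𝓛 on monomials. The two
  -- conjugations leave g itself under `ev`, so that `≃` applies to it directly.
  row : LaurentPoly → ℤ → ℂ
  row g j = conj (ev (λ k → conj (𝓛 (z^ (j ℤ.+ ℤ.- k)))) g)

  ⟪⟫≈ev : ∀ f g → ⟪ f , g ⟫ ≈ ev (row g) f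
  ⟪⟫≈ev f g = trans (linear≈ev linear (f ⊗ (conjCoeff g) at-1/z))
    (trans (ev-⊗ (λ k → 𝓛 (z^ k)) f ((conjCoeff g) at-1/z))
      (ev-cong (λ j → trans (reflexive (ev-at-1/z (λ k → 𝓛 (z^ (j ℤ.+ k))) (conjCoeff g)))
                            (ev-conjCoeff (λ k → 𝓛 (z^ (j ℤ.+ ℤ.- k))) g)) f))

  ⟪⟫-congˡ : ∀ {f f′} g → f ≃ f′ → ⟪ f , g ⟫ ≈ ⟪ f′ , g ⟫
  ⟪⟫-congˡ {f} {f′} g f≃f′ = trans (⟪⟫≈ev f g) (trans (ev-≈ f≃f′ (row g)) (sym (⟪⟫≈ev f′ g)))

  ⟪⟫-congʳ : ∀ f {g g′} → g ≃ g′ → ⟪ f , g ⟫ ≈ ⟪ f , g′ ⟫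
  ⟪⟫-congʳ f {g} {g′} g≃g′ = trans (⟪⟫≈ev f g)
    (trans (ev-cong (λ j → conj-cong (ev-≈ g≃g′ (λ k → conj (𝓛 (z^ (j ℤ.+ ℤ.- k)))))) f)
      (sym (⟪⟫≈ev f g′)))

  ⟪⟫-⊖•ˡ : ∀ f a g h → ⟪ f ⊖ a • g , h ⟫ ≈ ⟪ f , h ⟫ - a * ⟪ g , h ⟫
  ⟪⟫-⊖•ˡ f a g h = trans (⟪⟫≈ev (f ⊖ a • g) h) (trans (ev-⊖• (row h) f a g)
    (sym (+-cong (⟪⟫≈ev f h) (-‿cong (*-congˡ {a} (⟪⟫≈ev g h))))))

  row-⊖• : ∀ g a h j → row (g ⊖ a • h) j ≈ row g j + - conj a * row h j
  row-⊖• g a h j = trans (conj-cong (ev-⊖• T g a h)) (trans (conj-+ (ev T g) (- (a * ev T h)))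
    (+-congˡ (trans (conj-neg (a * ev T h)) (trans (-‿cong (conj-* a (ev T h)))
      (Id.neg-* (conj a) (row h j))))))
    where
    T : ℤ → ℂ
    T k = conj (𝓛 (z^ (j ℤ.+ ℤ.- k)))

  ⟪⟫-⊖•ʳ : ∀ f g a h → ⟪ f , g ⊖ a • h ⟫ ≈ ⟪ f , g ⟫ - conj a * ⟪ f , h ⟫
  ⟪⟫-⊖•ʳ f g a h = begin
    ⟪ f , g ⊖ a • h ⟫                                 ≈⟨ ⟪⟫≈ev f (g ⊖ a • h) ⟩
    ev (row (g ⊖ a • h)) f                            ≈⟨ ev-cong (row-⊖• g a h) f ⟩
    ev (λ j → row g j + - conj a * row h j) f
      ≈⟨ ev-+ (row g) (λ j → - conj a * row h j) f ⟩
    ev (row g) f + ev (λ j → - conj a * row h j) f    ≈⟨ +-congˡ (ev-* (- conj a) (row h) f) ⟩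
    ev (row g) f + - conj a * ev (row h) f
      ≈⟨ +-congˡ (Id.neg-* (conj a) (ev (row h) f)) ⟨
    ev (row g) f - conj a * ev (row h) f
      ≈⟨ +-cong (⟪⟫≈ev f g) (-‿cong (*-congˡ {conj a} (⟪⟫≈ev f h))) ⟨
    ⟪ f , g ⟫ - conj a * ⟪ f , h ⟫                    ∎

  -- The form is Toeplitz: the pairing of zʲ with zᵏ depends only on j - k.
  ⟪⟫-shift : ∀ i f g → ⟪ z^ i ⊗ f , z^ i ⊗ g ⟫ ≈ ⟪ f , g ⟫
  ⟪⟫-shift i f g = trans (⟪⟫≈ev (z^ i ⊗ f) (z^ i ⊗ g)) (trans (ev-z^ (row (z^ i ⊗ g)) i f)
    (trans (ev-cong (λ j → conj-cong (trans (ev-z^ (λ k → conj (𝓛 (z^ (i ℤ.+ j ℤ.+ ℤ.- k)))) i g)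
      (ev-cong (λ k → reflexive (≡.cong (λ l → conj (𝓛 (z^ l))) (cancel i j k))) g))) f)
      (sym (⟪⟫≈ev f g))))
    where
    open ℤSolver.+-*-Solver
    cancel : ∀ i j k → i ℤ.+ j ℤ.+ ℤ.- (i ℤ.+ k) ≡ j ℤ.+ ℤ.- k
    cancel = solve 3 (λ i j k → i :+ j :+ :- (i :+ k) := j :+ :- k) ≡.refl

-- Recurrences under the form, orthogonality to reversed polynomials, and norms.

module Norms {c ℓ₁ ℓ₂} (R : Reals c ℓ₁ ℓ₂) (α : ℕ → Complex.ℂ R)
             (∣α∣<1 : ∀ n → Complex._<ℝ_ R (Complex.∣_∣ R (α n)) (Complex.1ℝ R))
             (𝓛 : Laurent.LaurentPoly R → Complex.ℂ R)
             (isOrthogonality : OrthogonalPolynomials.IsOrthogonalityFunctional R α 𝓛) where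
  open Complex R
  open Laurent R
  open OrthogonalPolynomials R α
  open Moments 𝓛
  open IsOrthogonalityFunctional isOrthogonality
  open ComplexProperties R
  open Evaluation R
  open Szegő R α
  open Form R α 𝓛 linear
  open CommutativeRing ℂ-commutativeRing
    using (setoid; refl; sym; trans; +-cong; +-congˡ; *-congˡ; *-congʳ; -‿cong; +-group;
           *-identityˡ; +-identityʳ; *-cong)
  open SetoidReasoning setoid
  open GroupProperties +-group using () renaming (x∙y⁻¹≈ε⇒x≈y to x-y≈0⇒x≈y)
  private
    module Id = RingIdentities ℂ-commutativeRing
    module ℝ where
      open Reals R public
      open RealProperties R public

  -- The second slot is conjugate-linear, so the ᾱᵣ of the recurrence comes out as αᵣ.
  ⟪⟫-Φ-suc : ∀ g n r → ⟪ g , z^ (+ n) ⊗ Φ (suc r) ⟫ ≈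
                       ⟪ g , z^ (+ suc n) ⊗ Φ r ⟫ - α r * ⟪ g , z^ (+ n) ⊗ Φ* r ⟫
  ⟪⟫-Φ-suc g n r = begin
    ⟪ g , z^ (+ n) ⊗ Φ (suc r) ⟫
      ≈⟨ ⟪⟫-congʳ g (⊗-⊖• (+ n) (z^ 1ℤ ⊗ Φ r) (conj (α r)) (Φ* r)) ⟩
    ⟪ g , z^ (+ n) ⊗ (z^ 1ℤ ⊗ Φ r) ⊖ conj (α r) • (z^ (+ n) ⊗ Φ* r) ⟫
      ≈⟨ ⟪⟫-⊖•ʳ g (z^ (+ n) ⊗ (z^ 1ℤ ⊗ Φ r)) (conj (α r)) (z^ (+ n) ⊗ Φ* r) ⟩
    ⟪ g , z^ (+ n) ⊗ (z^ 1ℤ ⊗ Φ r) ⟫ - conj (conj (α r)) * ⟪ g , z^ (+ n) ⊗ Φ* r ⟫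
      ≈⟨ +-cong (sym (⟪⟫-congʳ g (z^suc⊗ n (Φ r))))
                (-‿cong (*-congʳ {⟪ g , z^ (+ n) ⊗ Φ* r ⟫} (conj-involutive (α r)))) ⟩
    ⟪ g , z^ (+ suc n) ⊗ Φ r ⟫ - α r * ⟪ g , z^ (+ n) ⊗ Φ* r ⟫ ∎

  ⟪⟫-Φ*-suc : ∀ g n r → ⟪ g , z^ (+ n) ⊗ Φ* (suc r) ⟫ ≈
                        ⟪ g , z^ (+ n) ⊗ Φ* r ⟫ - conj (α r) * ⟪ g , z^ (+ suc n) ⊗ Φ r ⟫
  ⟪⟫-Φ*-suc g n r = begin
    ⟪ g , z^ (+ n) ⊗ Φ* (suc r) ⟫
      ≈⟨ ⟪⟫-congʳ g (⊗-congˡ (+ n) (Φ*-suc r)) ⟩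
    ⟪ g , z^ (+ n) ⊗ (Φ* r ⊖ α r • (z^ 1ℤ ⊗ Φ r)) ⟫
      ≈⟨ ⟪⟫-congʳ g (⊗-⊖• (+ n) (Φ* r) (α r) (z^ 1ℤ ⊗ Φ r)) ⟩
    ⟪ g , z^ (+ n) ⊗ Φ* r ⊖ α r • (z^ (+ n) ⊗ (z^ 1ℤ ⊗ Φ r)) ⟫
      ≈⟨ ⟪⟫-⊖•ʳ g (z^ (+ n) ⊗ Φ* r) (α r) (z^ (+ n) ⊗ (z^ 1ℤ ⊗ Φ r)) ⟩
    ⟪ g , z^ (+ n) ⊗ Φ* r ⟫ - conj (α r) * ⟪ g , z^ (+ n) ⊗ (z^ 1ℤ ⊗ Φ r) ⟫
      ≈⟨ +-congˡ (-‿cong (*-congˡ {conj (α r)} (⟪⟫-congʳ g (z^suc⊗ n (Φ r))))) ⟨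
    ⟪ g , z^ (+ n) ⊗ Φ* r ⟫ - conj (α r) * ⟪ g , z^ (+ suc n) ⊗ Φ r ⟫ ∎

  -- Eliminating the pairing with zⁿ⁺¹Φᵣ leaves a single power zⁿ throughout, which permits
  -- induction on r with n fixed.
  ⟪⟫-Φ*-combined : ∀ g n r → ⟪ g , z^ (+ n) ⊗ Φ* (suc r) ⟫ ≈
          (1ℂ - conj (α r) * α r) * ⟪ g , z^ (+ n) ⊗ Φ* r ⟫
            - conj (α r) * ⟪ g , z^ (+ n) ⊗ Φ (suc r) ⟫
  ⟪⟫-Φ*-combined g n r = Id.star-step (⟪⟫-Φ*-suc g n r) (⟪⟫-Φ-suc g n r) refl

  -- The combined recurrence puts Φ*ᵣ in the span of Φ₀, ..., Φᵣ, and Φₘ is orthogonal to all of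
  -- these when r < m. The factor z⁰ makes this the case n = 0 of `⟪⟫-Φ*-combined`.
  ⟪Φ,Φ*⟫ : ∀ {m} r → r ℕ.< m → ⟪ Φ m , z^ 0ℤ ⊗ Φ* r ⟫ ≈ 0ℂ
  ⟪Φ,Φ*⟫ {m} zero    r<m = trans (⟪⟫-congʳ (Φ m) (≃-trans (z^0⊗ (Φ* 0)) Φ*-zero))
    (orthogonal m 0 (ℕₚ.>⇒≢ r<m))
  ⟪Φ,Φ*⟫ {m} (suc r) r<m = trans (⟪⟫-Φ*-combined (Φ m) 0 r)
    (Id.combine-zero (1ℂ - conj (α r) * α r) (conj (α r))
      (⟪Φ,Φ*⟫ r (ℕₚ.<-trans (ℕₚ.n<1+n r) r<m))
      (trans (⟪⟫-congʳ (Φ m) (z^0⊗ (Φ (suc r)))) (orthogonal m (suc r) (ℕₚ.>⇒≢ r<m))))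

  ⟪Φ-suc⟫ : ∀ r g → ⟪ Φ (suc r) , g ⟫ ≈ ⟪ z^ 1ℤ ⊗ Φ r , g ⟫ - conj (α r) * ⟪ Φ* r , g ⟫
  ⟪Φ-suc⟫ r g = ⟪⟫-⊖•ˡ (z^ 1ℤ ⊗ Φ r) (conj (α r)) (Φ* r) g

  ⟪Φ*-suc⟫ : ∀ r g → ⟪ Φ* (suc r) , g ⟫ ≈ ⟪ Φ* r , g ⟫ - α r * ⟪ z^ 1ℤ ⊗ Φ r , g ⟫
  ⟪Φ*-suc⟫ r g = trans (⟪⟫-congˡ g (Φ*-suc r)) (⟪⟫-⊖•ˡ (Φ* r) (α r) (z^ 1ℤ ⊗ Φ r) g)

  -- Mirror image of `⟪Φ,Φ*⟫`. Hermitian symmetry of the form is not among the hypotheses, so the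
  -- elimination is repeated in the first slot.
  ⟪Φ*,Φ⟫ : ∀ {m} r → r ℕ.< m → ⟪ Φ* r , Φ m ⟫ ≈ 0ℂ
  ⟪Φ*,Φ⟫ {m} zero    r<m = trans (⟪⟫-congˡ (Φ m) Φ*-zero) (orthogonal 0 m (ℕₚ.<⇒≢ r<m))
  ⟪Φ*,Φ⟫ {m} (suc r) r<m = trans
    (Id.star-step (⟪Φ*-suc⟫ r (Φ m)) (⟪Φ-suc⟫ r (Φ m)) refl)
    (Id.combine-zero (1ℂ - α r * conj (α r)) (α r)
      (⟪Φ*,Φ⟫ r (ℕₚ.<-trans (ℕₚ.n<1+n r) r<m)) (orthogonal (suc r) m (ℕₚ.<⇒≢ r<m)))

  -- The product of 1 - |αⱼ|² over j < r, kept real so that its positivity can be expressed.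
  ν : ℕ → ℝ
  ν zero    = 1ℝ
  ν (suc r) = (1ℝ ℝ.- ∣ α r ∣ ℝ.* ∣ α r ∣) ℝ.* ν r

  ν-pos : ∀ r → 0ℝ <ℝ ν r
  ν-pos zero    = ℝ.0<1
  ν-pos (suc r) = ℝ.*-pos (ℝ.<.<-respˡ-≈ (ℝC.-‿inverseʳ _) (ℝ.+-monoˡ-< _ ∣α∣²<1)) (ν-pos r)
    where
    module ℝC = CommutativeRing ℝ.commutativeRing
    ∣α∣²<1 : ∣ α r ∣ ℝ.* ∣ α r ∣ <ℝ 1ℝ
    ∣α∣²<1 = ℝ.<.<-respʳ-≈ (ℝC.*-identityˡ 1ℝ)
      (ℝ.square-mono (ℝ.+-pos (ℝ.sqrt-nonneg (normSq-nonneg (α r))) ℝ.0<1) (∣α∣<1 r))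

  -- Both norms go through one induction: expanding either at r + 1 calls for the norm of zΦᵣ, which
  -- the shift reduces to that of Φᵣ, and for the norm of Φ*ᵣ.
  norms : ∀ r → (⟪ Φ r , Φ r ⟫ ≈ fromℝ (ν r)) × (⟪ Φ* r , Φ* r ⟫ ≈ fromℝ (ν r))
  norms zero = ⟪1,1⟫ , trans (trans (⟪⟫-congˡ (Φ* 0) Φ*-zero) (⟪⟫-congʳ (Φ 0) Φ*-zero)) ⟪1,1⟫
    where
    ⟪1,1⟫ : ⟪ Φ 0 , Φ 0 ⟫ ≈ 1ℂ
    ⟪1,1⟫ = begin
      𝓛 (Φ 0 ⊗ (conjCoeff (Φ 0)) at-1/z)    ≈⟨ linear≈ev linear (Φ 0 ⊗ (conjCoeff (Φ 0)) at-1/z) ⟩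
      1ℂ * conj 1ℂ * 𝓛 1ᴸ + 0ℂ              ≈⟨ +-identityʳ (1ℂ * conj 1ℂ * 𝓛 1ᴸ) ⟩
      1ℂ * conj 1ℂ * 𝓛 1ᴸ
        ≈⟨ *-cong (trans (*-identityˡ (conj 1ℂ)) conj-1) normalised ⟩
      1ℂ * 1ℂ                               ≈⟨ *-identityˡ 1ℂ ⟩
      1ℂ                                    ∎
  norms (suc r) =
    trans (Id.orthogonal-norm (⟪Φ-suc⟫ r Φ′) (⟪Φ*,Φ⟫ r (ℕₚ.n<1+n r)) (⟪-,Φ-suc⟫ zΦ)
                              v≈ u≈ k≈) fold-ν ,
    trans (Id.star-norm (⟪Φ*-suc⟫ r (Φ* (suc r))) (⟪-,Φ*-suc⟫ (Φ* r)) w≈ (⟪-,Φ*-suc⟫ zΦ)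
                        v≈ u≈ k≈) fold-ν
    where
    zΦ Φ′ : LaurentPoly
    zΦ = z^ 1ℤ ⊗ Φ r
    Φ′ = Φ (suc r)

    ⟪-,Φ-suc⟫ : ∀ g → ⟪ g , Φ′ ⟫ ≈ ⟪ g , zΦ ⟫ - α r * ⟪ g , Φ* r ⟫
    ⟪-,Φ-suc⟫ g = trans (⟪⟫-⊖•ʳ g zΦ (conj (α r)) (Φ* r))
      (+-congˡ (-‿cong (*-congʳ {⟪ g , Φ* r ⟫} (conj-involutive (α r)))))

    ⟪-,Φ*-suc⟫ : ∀ g → ⟪ g , Φ* (suc r) ⟫ ≈ ⟪ g , Φ* r ⟫ - conj (α r) * ⟪ g , zΦ ⟫
    ⟪-,Φ*-suc⟫ g = trans (⟪⟫-congʳ g (Φ*-suc r)) (⟪⟫-⊖•ʳ g (Φ* r) (α r) zΦ)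

    u≈ : ⟪ zΦ , zΦ ⟫ ≈ fromℝ (ν r)
    u≈ = trans (⟪⟫-shift 1ℤ (Φ r) (Φ r)) (proj₁ (norms r))

    k≈ : ⟪ Φ* r , Φ* r ⟫ ≈ fromℝ (ν r)
    k≈ = proj₂ (norms r)

    -- The mixed products come from orthogonality: expanding Φᵣ₊₁ in ⟪Φᵣ₊₁,Φ*ᵣ⟫ = 0 determines v,
    -- and in ⟪Φ*ᵣ,Φᵣ₊₁⟫ = 0 determines w.
    v≈ : ⟪ zΦ , Φ* r ⟫ ≈ conj (α r) * ⟪ Φ* r , Φ* r ⟫
    v≈ = x-y≈0⇒x≈y _ _ (trans (sym (⟪Φ-suc⟫ r (Φ* r)))
      (trans (sym (⟪⟫-congʳ Φ′ (z^0⊗ (Φ* r)))) (⟪Φ,Φ*⟫ r (ℕₚ.n<1+n r))))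

    w≈ : ⟪ Φ* r , zΦ ⟫ ≈ α r * ⟪ Φ* r , Φ* r ⟫
    w≈ = x-y≈0⇒x≈y _ _ (trans (sym (⟪-,Φ-suc⟫ (Φ* r))) (⟪Φ*,Φ⟫ r (ℕₚ.n<1+n r)))

    fold-ν : (1ℂ - conj (α r) * α r) * fromℝ (ν r) ≈ fromℝ (ν (suc r))
    fold-ν = trans (*-congʳ {fromℝ (ν r)} (sym (1-conj[z]*z (α r))))
      (sym (fromℝ-* (1ℝ ℝ.- ∣ α r ∣ ℝ.* ∣ α r ∣) (ν r)))

  -- The real part is ν > 0, so the squared modulus is a positive square plus a nonnegative one.
  ⟪Φ,Φ⟫-NonZero : ∀ r → NonZero ⟪ Φ r , Φ r ⟫
  ⟪Φ,Φ⟫-NonZero r = normSq-pos⇒NonZero (ℝ.<.<-respʳ-≈ (CommutativeRing.+-comm ℝ.commutativeRing _ _)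
    (ℝ.+-pos (ℝ.square-nonneg (im h)) (ℝ.*-pos 0<re 0<re)))
    where
    h : ℂ
    h = ⟪ Φ r , Φ r ⟫
    0<re : 0ℝ <ℝ re h
    0<re = ℝ.<.<-respʳ-≈ (CommutativeRing.sym ℝ.commutativeRing (proj₁ (proj₁ (norms r)))) (ν-pos r)

-- Discarding the paths that start with a down-step.

kind≢down⇒¬StartsDown : ∀ {P Q} (p : Path P Q) → kind p ≢ down → ¬ StartsDown p
kind≢down⇒¬StartsDown _ k≢down starts-down = k≢down ≡.refl

kind≡down⇒StartsDown : ∀ {P Q} (p : Path P Q) → kind p ≡ down → StartsDown p
kind≡down⇒StartsDown (down ◅ p) _ = starts-down

-- `paths` is grouped by first step, so the filter keeps three blocks whole and drops the last.
-- Reassociation isolates that last block.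
filter-¬StartsDown : ∀ k a b {c d} (e : + k ℤ.+ a ≡ c) →
  filter (¬? ∘ startsDown?) (paths k a b {d = d} e) ≡ stay _ _ ++ diags k a b e ++ levels k a b e
filter-¬StartsDown k a b {c} {d} e = begin
  filter ¬down? (st ++ di ++ le ++ do′)
    ≡⟨ ≡.cong (λ ps → filter ¬down? (st ++ ps)) (++-assoc di le do′) ⟨
  filter ¬down? (st ++ (di ++ le) ++ do′)
    ≡⟨ ≡.cong (filter ¬down?) (++-assoc st (di ++ le) do′) ⟨
  filter ¬down? ((st ++ di ++ le) ++ do′)
    ≡⟨ filter-++ ¬down? (st ++ di ++ le) do′ ⟩
  filter ¬down? (st ++ di ++ le) ++ filter ¬down? do′
    ≡⟨ ≡.cong₂ _++_ (filter-all ¬down? kept) (filter-none ¬down? dropped) ⟩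
  (st ++ di ++ le) ++ []                                 ≡⟨ ++-identityʳ (st ++ di ++ le) ⟩
  st ++ di ++ le                                         ∎
  where
  open ≡.≡-Reasoning
  ¬down? = ¬? ∘ startsDown?
  st di le do′ : List (Path (a , b) (c , d))
  st  = stay _ _
  di  = diags k a b e
  le  = levels k a b e
  do′ = downs k a b e

  keep : ∀ {l} {p : Path (a , b) (c , d)} → l ≢ down → kind p ≡ l → ¬ StartsDown p
  keep {p = p} l≢down k≡l = kind≢down⇒¬StartsDown p (λ k≡down → l≢down (≡.trans (≡.sym k≡l) k≡down))

  kept : All (¬_ ∘ StartsDown) (st ++ di ++ le)
  kept = All.++⁺ (All.tabulate (λ p∈ → keep (λ ()) (stay-kind (a , b) (c , d) p∈)))
    (All.++⁺ (All.tabulate (λ p∈ → keep (λ ()) (diags-kind k a b e p∈)))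
             (All.tabulate (λ p∈ → keep (λ ()) (levels-kind k a b e p∈))))

  dropped : All (¬_ ∘ ¬_ ∘ StartsDown) do′
  dropped = All.tabulate (λ {p} p∈ ¬down → ¬down (kind≡down⇒StartsDown p (downs-kind k a b e p∈)))

-- First-step recursions for weighted path sums.

module PathSums {c ℓ₁ ℓ₂} (R : Reals c ℓ₁ ℓ₂) (α : ℕ → Complex.ℂ R)
                (α≢0 : ∀ n → Complex.NonZero R (α n)) where
  open Complex R
  open Weights R α α≢0
  open ComplexProperties R
  open CommutativeRing ℂ-commutativeRing
    using (setoid; refl; sym; trans; +-cong; +-congˡ; +-congʳ; +-identityˡ; +-identityʳ;
           +-assoc; zeroʳ; distribˡ; *-congˡ)
  open SetoidReasoning setoid
  open Reals R using () renaming (_-_ to _-ℝ_; _*_ to _*ℝ_)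

  1/conj[α] : ℕ → ℂ
  1/conj[α] b = reciprocal (conj (α b)) (conj-NonZero (α≢0 b))

  -- downWt b belongs to the down step from height b + 1.
  levelWt downWt : ℕ → ℂ
  levelWt b = - (conj α[ b -1] * 1/conj[α] b)
  downWt  b = conj α[ b -1] * 1/conj[α] b * fromℝ (1ℝ -ℝ ∣ α b ∣ *ℝ ∣ α b ∣)

  δ : ℕ → ℕ → ℂ
  δ r s with r ℕₚ.≟ s
  ... | yes _ = 1ℂ
  ... | no  _ = 0ℂ

  -- `sch` omits the paths that start down and `allPaths` includes them. Any path may follow a first
  -- step, so `sch` continues with `allPaths`. At width 0 only the empty path avoids starting down,
  -- whence `δ`; at height 0 no down-step exists, so the two sums agree.
  sch allPaths : (n r s : ℕ) → ℂ
  sch zero    r s = δ r s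
  sch (suc n) r s = 1ℂ * allPaths n (suc r) s + levelWt r * allPaths n r s
  allPaths n zero    s = sch n zero s
  allPaths n (suc r) s = sch n (suc r) s + downWt r * allPaths n r s

  sumWt : ∀ {P Q} → List (Path P Q) → ℂ
  sumWt ps = foldr _+_ 0ℂ (List.map wt ps)

  sumWt-++ : ∀ {P Q} (ps qs : List (Path P Q)) → sumWt (ps ++ qs) ≈ sumWt ps + sumWt qs
  sumWt-++ []       qs = sym (+-identityˡ (sumWt qs))
  sumWt-++ (p ∷ ps) qs = trans (+-congˡ (sumWt-++ ps qs))
    (sym (+-assoc (wt p) (sumWt ps) (sumWt qs)))

  sumWt-◅ : ∀ {P Q S} (st : Step P Q) (ps : List (Path Q S)) →
            sumWt (List.map (st ◅_) ps) ≈ stepWt st * sumWt ps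
  sumWt-◅ st []       = sym (zeroʳ (stepWt st))
  sumWt-◅ st (p ∷ ps) = trans (+-congˡ (sumWt-◅ st ps))
    (sym (distribˡ (stepWt st) (wt p) (sumWt ps)))

  sumWt-stay-≡ : ∀ P → sumWt (stay P P) ≈ 1ℂ
  sumWt-stay-≡ P with Prod.≡-dec ℤₚ._≟_ ℕₚ._≟_ P P
  ... | yes ≡.refl = +-identityʳ 1ℂ
  ... | no  P≢P    = ⊥-elim (P≢P ≡.refl)

  sumWt-stay-≢ : ∀ P Q → P ≢ Q → sumWt (stay P Q) ≈ 0ℂ
  sumWt-stay-≢ P Q P≢Q with Prod.≡-dec ℤₚ._≟_ ℕₚ._≟_ P Q
  ... | yes P≡Q = ⊥-elim (P≢Q P≡Q)
  ... | no  _   = refl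

  sumWt-stay-zero : ∀ a b {c d} → + 0 ℤ.+ a ≡ c → sumWt (stay (a , b) (c , d)) ≈ δ b d
  sumWt-stay-zero a b {c} {d} e with ≡.trans (≡.sym (ℤₚ.+-identityˡ a)) e | b ℕₚ.≟ d
  ... | ≡.refl | yes ≡.refl = sumWt-stay-≡ (a , b)
  ... | ≡.refl | no  b≢d    = sumWt-stay-≢ (a , b) (a , d) (b≢d ∘ ≡.cong proj₂)

  sumWt-stay-suc : ∀ k a b {c d} → + suc k ℤ.+ a ≡ c → sumWt (stay (a , b) (c , d)) ≈ 0ℂ
  sumWt-stay-suc k a b {c} {d} e = sumWt-stay-≢ (a , b) (c , d) λ P≡Q → ℤₚ.<⇒≢
    (≡.subst₂ ℤ._<_ (ℤₚ.+-identityˡ a) e (ℤₚ.+-monoˡ-< a {0ℤ} {+ suc k} (ℤ.+<+ ℕ.z<s)))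
    (≡.cong proj₁ P≡Q)

  -- Stated for the three blocks instead of a filtered list, so that it serves both `sumWt-paths`,
  -- where the down block is added back, and `ΣSch≈sch`.
  sumWt-¬StartsDown : ∀ k a b {c d} (e : + k ℤ.+ a ≡ c) →
    sumWt (stay (a , b) (c , d)) + (sumWt (diags k a b {d = d} e) + sumWt (levels k a b {d = d} e)) ≈
    sch k b d
  sumWt-paths : ∀ k a b {c d} (e : + k ℤ.+ a ≡ c) → sumWt (paths k a b {d = d} e) ≈ allPaths k b d

  sumWt-¬StartsDown zero a b {c} {d} e = begin
    sumWt (stay (a , b) (c , d)) + (0ℂ + 0ℂ)
      ≈⟨ +-cong (sumWt-stay-zero a b e) (+-identityˡ 0ℂ) ⟩
    δ b d + 0ℂ                                  ≈⟨ +-identityʳ (δ b d) ⟩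
    δ b d                                       ∎
  sumWt-¬StartsDown (suc k) a b {c} {d} e = begin
    sumWt (stay (a , b) (c , d)) +
    (sumWt (List.map (diag {a} ◅_) ds) + sumWt (List.map (level {a} ◅_) ls))
      ≈⟨ +-cong (sumWt-stay-suc k a b e) (+-cong (sumWt-◅ (diag {a}) ds) (sumWt-◅ (level {a}) ls)) ⟩
    0ℂ + (1ℂ * sumWt ds + levelWt b * sumWt ls)
      ≈⟨ +-identityˡ (1ℂ * sumWt ds + levelWt b * sumWt ls) ⟩
    1ℂ * sumWt ds + levelWt b * sumWt ls
      ≈⟨ +-cong (*-congˡ {1ℂ} (sumWt-paths k (ℤ.suc a) (suc b) (shift k a e)))
                (*-congˡ {levelWt b} (sumWt-paths k (ℤ.suc a) b (shift k a e))) ⟩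
    sch (suc k) b d ∎
    where
    ds : List (Path (ℤ.suc a , suc b) (c , d))
    ds = paths k (ℤ.suc a) (suc b) (shift k a e)
    ls : List (Path (ℤ.suc a , b) (c , d))
    ls = paths k (ℤ.suc a) b (shift k a e)

  sumWt-paths k a b {c} {d} e = begin
    sumWt (st ++ di ++ le ++ do′)                        ≈⟨ sumWt-++ st (di ++ le ++ do′) ⟩
    sumWt st + sumWt (di ++ le ++ do′)                   ≈⟨ +-congˡ (sumWt-++ di (le ++ do′)) ⟩
    sumWt st + (sumWt di + sumWt (le ++ do′))            ≈⟨ +-congˡ (+-congˡ (sumWt-++ le do′)) ⟩
    sumWt st + (sumWt di + (sumWt le + sumWt do′))
      ≈⟨ +-congˡ (+-assoc (sumWt di) (sumWt le) (sumWt do′)) ⟨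
    sumWt st + (sumWt di + sumWt le + sumWt do′)
      ≈⟨ +-assoc (sumWt st) (sumWt di + sumWt le) (sumWt do′) ⟨
    sumWt st + (sumWt di + sumWt le) + sumWt do′         ≈⟨ +-congʳ (sumWt-¬StartsDown k a b e) ⟩
    sch k b d + sumWt do′                                ≈⟨ with-downs b ⟩
    allPaths k b d                                       ∎
    where
    st : List (Path (a , b) (c , d))
    st = stay _ _
    di = diags k a b {d = d} e
    le = levels k a b {d = d} e
    do′ = downs k a b {d = d} e

    with-downs : ∀ b → sch k b d + sumWt (downs k a b {d = d} e) ≈ allPaths k b d
    with-downs zero    = +-identityʳ (sch k 0 d)
    with-downs (suc b) = +-congˡ (trans (sumWt-◅ down (paths k a b e))
      (*-congˡ {downWt b} (sumWt-paths k a b e)))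

  ΣSch≈sch : ∀ n r s → ΣSch n r s ≈ sch n r s
  ΣSch≈sch n r s = begin
    sumWt (Sch n r s)              ≡⟨ ≡.cong sumWt (filter-¬StartsDown n 0ℤ r e) ⟩
    sumWt (st ++ di ++ le)         ≈⟨ sumWt-++ st (di ++ le) ⟩
    sumWt st + sumWt (di ++ le)    ≈⟨ +-congˡ (sumWt-++ di le) ⟩
    sumWt st + (sumWt di + sumWt le) ≈⟨ sumWt-¬StartsDown n 0ℤ r e ⟩
    sch n r s                      ∎
    where
    e : + n ℤ.+ 0ℤ ≡ + n
    e = ℤₚ.+-identityʳ (+ n)
    st : List (Path (0ℤ , r) (+ n , s))
    st = stay _ _
    di = diags n 0ℤ r {d = s} e
    le = levels n 0ℤ r {d = s} e

-- Moments as weighted path sums.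

module Expansion {c ℓ₁ ℓ₂} (R : Reals c ℓ₁ ℓ₂) (α : ℕ → Complex.ℂ R)
                 (0<∣α∣ : ∀ n → Complex.NonZero R (α n))
                 (∣α∣<1 : ∀ n → Complex._<ℝ_ R (Complex.∣_∣ R (α n)) (Complex.1ℝ R))
                 (𝓛 : Laurent.LaurentPoly R → Complex.ℂ R)
                 (isOrthogonality : OrthogonalPolynomials.IsOrthogonalityFunctional R α 𝓛) where
  open Complex R
  open Laurent R
  open OrthogonalPolynomials R α
  open Moments 𝓛
  open IsOrthogonalityFunctional isOrthogonality
  open Weights R α 0<∣α∣ using (α[_-1])
  open ComplexProperties R
  open Evaluation R
  open Szegő R α
  open Form R α 𝓛 linear
  open Norms R α ∣α∣<1 𝓛 isOrthogonality
  open PathSums R α 0<∣α∣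
  open CommutativeRing ℂ-commutativeRing
    using (sym; trans; +-congʳ; -‿cong; *-congʳ; *-identityʳ; zeroʳ)
  private module Id = RingIdentities ℂ-commutativeRing

  conj[α]-inverse : ∀ b → conj (α b) * 1/conj[α] b ≈ 1ℂ
  conj[α]-inverse b = *-reciprocal (conj (α b)) (conj-NonZero (0<∣α∣ b))

  module _ (s : ℕ) where
    h : ℂ
    h = ⟪ Φ s , Φ s ⟫

    ⟪Φ,Φ⟫≈δ : ∀ r → ⟪ Φ s , Φ r ⟫ ≈ h * δ r s
    ⟪Φ,Φ⟫≈δ r with r ℕₚ.≟ s
    ... | yes ≡.refl = sym (*-identityʳ h)
    ... | no  r≢s    = trans (orthogonal s r (r≢s ∘ ≡.sym)) (sym (zeroʳ h))

    -- Simultaneous induction: the first claim at n + 1 uses the second at n for heights r and r +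
    -- 1, and the second at r + 1 uses itself at r and the first at r + 1, both with the same n. The
    -- second claim is the pairing with Pᵣ after clearing the denominator αᵣ₋₁.
    ⟪Φ,zⁿΦ⟫  : ∀ n r → ⟪ Φ s , z^ (+ n) ⊗ Φ r ⟫ ≈ h * sch n r s
    ⟪Φ,zⁿΦ*⟫ : ∀ n r → ⟪ Φ s , z^ (+ n) ⊗ Φ* r ⟫ ≈ - (conj α[ r -1] * (h * allPaths n r s))

    ⟪Φ,zⁿΦ⟫ zero    r = trans (⟪⟫-congʳ (Φ s) (z^0⊗ (Φ r))) (⟪Φ,Φ⟫≈δ r)
    ⟪Φ,zⁿΦ⟫ (suc n) r = Id.level-step (conj[α]-inverse r) (⟪⟫-Φ*-suc (Φ s) n r)
      (⟪Φ,zⁿΦ*⟫ n r) (⟪Φ,zⁿΦ*⟫ n (suc r))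

    -- The convention α₋₁ = -1 makes the prefactor -ᾱ₋₁ equal to 1, matching Φ*₀ = Φ₀.
    ⟪Φ,zⁿΦ*⟫ n zero    = trans (⟪⟫-congʳ (Φ s) (⊗-congˡ (+ n) Φ*-zero))
      (trans (⟪Φ,zⁿΦ⟫ n 0) (trans (Id.neg-neg-1* (h * sch n 0 s))
        (-‿cong (*-congʳ {h * sch n 0 s} (sym (trans (conj-neg 1ℂ) (-‿cong conj-1)))))))
    ⟪Φ,zⁿΦ*⟫ n (suc r) = Id.down-step (conj[α]-inverse r)
      (trans (⟪⟫-Φ*-combined (Φ s) n r)
        (+-congʳ (*-congʳ {⟪ Φ s , z^ (+ n) ⊗ Φ* r ⟫} (sym (1-conj[z]*z (α r))))))
      (⟪Φ,zⁿΦ*⟫ n r) (⟪Φ,zⁿΦ⟫ n (suc r))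

-- Since `μ` divides by the norm of Φₛ, the conclusion supplies the proof that this norm is nonzero
-- together with the identity.
theorem3p10 : ∀ {c ℓ₁ ℓ₂} (R : Reals c ℓ₁ ℓ₂) →
    let open Complex R
        open Laurent R in
    (α : ℕ → ℂ) (0<∣α∣ : ∀ n → 0ℝ <ℝ ∣ α n ∣) (∣α∣<1 : ∀ n → ∣ α n ∣ <ℝ 1ℝ) →
    let open OrthogonalPolynomials R α
        open Weights R α 0<∣α∣ in
    (𝓛 : LaurentPoly → ℂ) → IsOrthogonalityFunctional 𝓛 →
    let open Moments 𝓛 in
    ∀ n r s → Σ[ Φₛ≠0 ∈ NonZero ⟪ Φ s , Φ s ⟫ ] μ n r s Φₛ≠0 ≈ ΣSch n r s
theorem3p10 R α 0<∣α∣ ∣α∣<1 𝓛 isOrthogonality n r s = Φₛ≠0 , (begin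
  ⟪ Φ s , z^ (+ n) ⊗ Φ r ⟫ * h⁻¹   ≈⟨ *-congʳ {h⁻¹} (⟪Φ,zⁿΦ⟫ s n r) ⟩
  h s * sch n r s * h⁻¹            ≈⟨ cancel (*-reciprocal (h s) Φₛ≠0) ⟩
  sch n r s                        ≈⟨ ΣSch≈sch n r s ⟨
  ΣSch n r s                       ∎)
  where
  open Complex R
  open Laurent R
  open OrthogonalPolynomials R α
  open Moments 𝓛
  open Weights R α 0<∣α∣
  open ComplexProperties R
  open Norms R α ∣α∣<1 𝓛 isOrthogonality
  open PathSums R α 0<∣α∣
  open Expansion R α 0<∣α∣ ∣α∣<1 𝓛 isOrthogonality
  open CommutativeRing ℂ-commutativeRing using (setoid; *-congʳ)
  open RingIdentities ℂ-commutativeRing using (cancel)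
  open SetoidReasoning setoid

  Φₛ≠0 : NonZero ⟪ Φ s , Φ s ⟫
  Φₛ≠0 = ⟪Φ,Φ⟫-NonZero s

  h⁻¹ : ℂ
  h⁻¹ = reciprocal ⟪ Φ s , Φ s ⟫ Φₛ≠0
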